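{- Let $q\geq 2$ be a prime power, $d\geq 6$, and $1\leq j\leq d$. For $0\leq i\leq d$ let $$Q_j(i)=(-1)^j\sum_{h=0}^{j}(-q)^{\binom{j-h}{2}+hd}{d-h \brack d-j}_b{d-i \brack h}_b,\qquad b=-q.$$ Then: (i) $|Q_j(i)|>|Q_j(i+1)|$ for all $0\leq i\leq d-1$, except when $q=2$, $i=d-1$, and $j=d$ or $j$ is even; (ii) if $j$ is odd, then $Q_j(1)\leq Q_j(i)$ for all $0\leq i\leq d$; (iii) if $j$ is even, then $Q_j(d-j+2)\leq Q_j(i)$ for all $0\leq i\leq d$; (iv) $|Q_j(1)|>|Q_j(i)|$ for all $2\leq i\leq d$.
   Context: For integers $m\geq 0$ and $l$, the Gaussian coefficient with base $b=-q$ is ${m \brack l}_b=\prod_{t=1}^{l}\frac{(-q)^{m-t+1}-1}{(-q)^t-1}$ for $0\leq l\leq m$, and $0$ if $l<0$ or $l>m$. The $Q_j(i)$ are the eigenvalues of the Hermitian forms graph $Q_q(d,j)$, whose vertices are the $d\times d$ Hermitian matrices over $\mathbb{F}_{q^2}$, two being adjacent iff their difference has rank $j$. -}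

module Defs where

open import Data.Nat as ℕ using (ℕ; zero; suc; _∸_; _≤?_)
open import Data.Nat.Combinatorics using (_C_)
open import Data.Nat.Primality using (Prime)
open import Data.Integer as ℤ using (ℤ; +_)
open import Data.Rational as ℚ using (ℚ; 0ℚ; 1ℚ; _÷_; ≢-nonZero)
open import Data.Product using (Σ; _×_)
open import Relation.Binary.PropositionalEquality using (_≡_)
open import Relation.Nullary using (yes; no)

IsPrimePower : ℕ → Set
IsPrimePower q = Σ ℕ λ p → Σ ℕ λ k → Prime p × 1 ℕ.≤ k × q ≡ p ℕ.^ k

toℚ : ℤ → ℚ
toℚ z = z ℚ./ 1

-- total division on ℚ (only ever used with nonzero denominators;
-- returns 0 on a zero denominator)
_÷'_ : ℚ → ℚ → ℚ
p ÷' r with r ℚ.≟ 0ℚ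
... | yes _ = 0ℚ
... | no r≢0 = _÷_ p r {{≢-nonZero r≢0}}

base : ℕ → ℤ
base q = ℤ.- (+ q)

-- Gaussian coefficient [m, l]_b with b = -q:
--   prod_{t=1}^{l} ((-q)^(m-t+1) - 1) / ((-q)^t - 1)  if l ≤ m, else 0
-- (only natural-number arguments occur in the statement, so l < 0 never arises)
gaussProd : ℕ → ℕ → ℕ → ℚ
gaussProd q m zero = 1ℚ
gaussProd q m (suc t) =
  gaussProd q m t ℚ.*
    (toℚ (base q ℤ.^ (m ∸ suc t ℕ.+ 1) ℤ.- + 1) ÷' toℚ (base q ℤ.^ suc t ℤ.- + 1))

gauss : ℕ → ℕ → ℕ → ℚ
gauss q m l with l ≤? m
... | yes _ = gaussProd q m l
... | no _ = 0ℚ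

sumTo : ℕ → (ℕ → ℚ) → ℚ
sumTo zero f = f 0
sumTo (suc n) f = sumTo n f ℚ.+ f (suc n)

Q : (q d j i : ℕ) → ℚ
Q q d j i =
  toℚ (ℤ.-1ℤ ℤ.^ j) ℚ.*
    sumTo j (λ h → toℚ (base q ℤ.^ (((j ∸ h) C 2) ℕ.+ h ℕ.* d))
                   ℚ.* gauss q (d ∸ h) (d ∸ j)
                   ℚ.* gauss q (d ∸ i) h)

{-# OPTIONS --safe #-}
-- Put k = d - j and n = d - i, keep k fixed, and divide Q_j(i) by (-1)^j b^C(j,2) to get U_n(j).
-- Pascal's rule gives U_{n+1}(j) = U_n(j) + b^(k+n+1) U_n(j-1), where U_0(j) is the Gaussian
-- coefficient [k+j, k]. The ratio r = U_n(j) / (b^(k+n+1) U_n(j-1)) has the sign (-1)^min(j,n+1),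
-- and -1/2 < r < 1 is preserved by n ↦ n + 1; since U_{n+1}(j) / U_n(j) = 1 + 1/r, it makes
-- |U_n(j)| strictly increasing in n. The bound holds from n = 0 on if q ≥ 3 and from n = 1 on if
-- q = 2, where n = 0 accounts for the exceptions. The signs of the r's determine the signs of the
-- Q_j(i), so the extremal statements follow from monotonicity and |U_0| < |U_2|.
module Submission where

open import Defs
open import Data.Nat using (ℕ; zero; suc; _∸_; _+_; _*_; _^_; _≤_; _<_; z≤n; s≤s; _≤?_; NonZero; nonTrivial⇒n>1)
open import Data.Nat.Combinatorics using (_C_; nC1≡n; nCk+nC[k+1]≡[n+1]C[k+1])
open import Data.Nat.Coprimality using (sym; 1-coprimeTo)
open import Data.Nat.Divisibility using (_∣_; ∣m∣n⇒∣m+n; ∣m+n∣m⇒∣n; ∣-refl; _∣0; ∣1⇒≡1)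
open import Data.Nat.Primality using (prime⇒nonTrivial; prime⇒nonZero)
import Data.Nat.Properties as ℕ
import Data.Nat.Tactic.RingSolver as NatSolver
open import Data.Integer using (ℤ; +_; -[1+_]; -1ℤ; 0ℤ; 1ℤ)
  renaming (_+_ to _+ℤ_; _*_ to _*ℤ_; _-_ to _-ℤ_; -_ to -ℤ_; _^_ to _^ℤ_; _<_ to _<ℤ_; _≤_ to _≤ℤ_; ∣_∣ to ∣_∣ℤ)
import Data.Integer as ℤB
import Data.Integer.Properties as ℤ
open import Data.Integer.Tactic.RingSolver using (solve; solve-∀)
open import Data.List using ([]; _∷_)
open import Data.Product using (_×_; _,_; proj₁; proj₂)
open import Data.Rational using (ℚ; ∣_∣; mkℚ; 0ℚ; 1ℚ; 1/_; ≢-nonZero; *<*; *≤*; ↥_)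
  renaming (_<_ to _<ℚ_; _≤_ to _≤ℚ_; _+_ to _+ℚ_; _*_ to _*ℚ_)
import Data.Rational.Properties as ℚ
open import Data.Sum using (_⊎_; inj₁; inj₂; [_,_]′)
open import Relation.Binary.PropositionalEquality
  using (_≡_; _≢_; refl; cong; cong₂; subst; subst₂; trans; module ≡-Reasoning)
  renaming (sym to ≡-sym)
open import Relation.Nullary using (¬_; yes; no; contradiction)

-- The constants -1/2 and 1 come from a recurrence for the ratios. Write r_n(j) for the ratio r at n
-- and j. For j ≥ 2, dividing the recurrence for U_(n+1)(j) by the one for U_(n+1)(j-1) gives
-- r_(n+1)(j) = r_n(j-1) (1 + r_n(j)) / (b (1 + r_n(j-1))). If all r_n(j) lie in (-1/2, 1), then 0 <
-- 1 + r_n(j) < 2 ≤ q, so |r_(n+1)(j)| < |r_n(j-1)| / (1 + r_n(j-1)), while b < 0 flips the sign;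
-- and t ↦ -t / (1 + t) exchanges (-1/2, 0) and (0, 1). The recurrence leaves a single d: with k
-- fixed, U_n(j-1) belongs to d - 1, so the bounds are proved for all j at once. At n = 0 the size
-- of r is about 1/q. For q = 2 this is the boundary value 1/2, and the terms ±1 in q^m - (-1)^m
-- decide on which side r falls.

-- Transfer between ℤ and ℚ

integral : ℤ → ℚ
integral z = mkℚ z 0 (sym (1-coprimeTo _))

-- `toℚ z` is normalised through a gcd and does not compute for a variable `z`; `integral z` does,
-- so the laws below go through it.
toℚ-integral : ∀ z → toℚ z ≡ integral z
toℚ-integral z = ℚ.↥p/↧p≡p (integral z)

toℚ-injective : ∀ {x y} → toℚ x ≡ toℚ y → x ≡ y
toℚ-injective {x} {y} eq =
  cong ↥_ (trans (≡-sym (toℚ-integral x)) (trans eq (toℚ-integral y)))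

toℚ-* : ∀ x y → toℚ (x *ℤ y) ≡ toℚ x *ℚ toℚ y
toℚ-* x y = ≡-sym (trans (cong₂ _*ℚ_ (toℚ-integral x) (toℚ-integral y)) refl)

toℚ-+ : ∀ x y → toℚ (x +ℤ y) ≡ toℚ x +ℚ toℚ y
toℚ-+ x y = ≡-sym (trans (cong₂ _+ℚ_ (toℚ-integral x) (toℚ-integral y))
  (cong toℚ (cong₂ _+ℤ_ (ℤ.*-identityʳ x) (ℤ.*-identityʳ y))))

toℚ-mono-≤ : ∀ {x y} → x ≤ℤ y → toℚ x ≤ℚ toℚ y
toℚ-mono-≤ {x} {y} x≤y = subst₂ _≤ℚ_ (≡-sym (toℚ-integral x)) (≡-sym (toℚ-integral y))
  (*≤* (subst₂ _≤ℤ_ (≡-sym (ℤ.*-identityʳ x)) (≡-sym (ℤ.*-identityʳ y)) x≤y))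

toℚ-mono-< : ∀ {x y} → x <ℤ y → toℚ x <ℚ toℚ y
toℚ-mono-< {x} {y} x<y = subst₂ _<ℚ_ (≡-sym (toℚ-integral x)) (≡-sym (toℚ-integral y))
  (*<* (subst₂ _<ℤ_ (≡-sym (ℤ.*-identityʳ x)) (≡-sym (ℤ.*-identityʳ y)) x<y))

∣toℚ∣ : ∀ x → ∣ toℚ x ∣ ≡ toℚ (+ ∣ x ∣ℤ)
∣toℚ∣ x = trans (cong ∣_∣ (toℚ-integral x)) (trans (abs x) (≡-sym (toℚ-integral (+ ∣ x ∣ℤ))))
  where
  abs : ∀ x → ∣ integral x ∣ ≡ integral (+ ∣ x ∣ℤ)
  abs (+ _) = refl
  abs -[1+ _ ] = refl

-- Division occurs only in the factors of `gaussProd`. Cross-multiplication absorbs one such factor,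
-- so that everything else can be argued over ℤ.
toℚ-÷' : ∀ a c {x y} → y ≢ 0ℤ → a *ℤ x ≡ c *ℤ y → toℚ a *ℚ (toℚ x ÷' toℚ y) ≡ toℚ c
toℚ-÷' a c {x} {y} y≢0 ax≡cy with toℚ y ℚ.≟ 0ℚ
... | yes y≡0 = contradiction (toℚ-injective y≡0) y≢0
... | no y≢0′ = begin
  toℚ a *ℚ (toℚ x *ℚ y⁻¹)   ≡⟨ ℚ.*-assoc (toℚ a) (toℚ x) y⁻¹ ⟨
  toℚ a *ℚ toℚ x *ℚ y⁻¹     ≡⟨ cong (_*ℚ y⁻¹) (toℚ-* a x) ⟨
  toℚ (a *ℤ x) *ℚ y⁻¹       ≡⟨ cong (λ z → toℚ z *ℚ y⁻¹) ax≡cy ⟩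
  toℚ (c *ℤ y) *ℚ y⁻¹       ≡⟨ cong (_*ℚ y⁻¹) (toℚ-* c y) ⟩
  toℚ c *ℚ toℚ y *ℚ y⁻¹     ≡⟨ ℚ.*-assoc (toℚ c) (toℚ y) y⁻¹ ⟩
  toℚ c *ℚ (toℚ y *ℚ y⁻¹)   ≡⟨ cong (toℚ c *ℚ_) (ℚ.*-inverseʳ (toℚ y) {{_}}) ⟩
  toℚ c *ℚ 1ℚ               ≡⟨ ℚ.*-identityʳ (toℚ c) ⟩
  toℚ c ∎
  where
  open ≡-Reasoning
  y⁻¹ : ℚ
  y⁻¹ = 1/_ (toℚ y) {{≢-nonZero y≢0′}}

-- Integral Gaussian coefficients and their quotient identities

-- Gaussian coefficients. For l > m the truncated exponent is harmless, since G b m l = 0.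
G : ℤ → ℕ → ℕ → ℤ
G b m zero = 1ℤ
G b zero (suc l) = 0ℤ
G b (suc m) (suc l) = G b m (suc l) +ℤ b ^ℤ (m ∸ l) *ℤ G b m l

G≡0 : ∀ b {m l} → m < l → G b m l ≡ 0ℤ
G≡0 b {zero} {suc l} _ = refl
G≡0 b {suc m} {suc l} (s≤s m<l) = begin
  G b m (suc l) +ℤ b ^ℤ (m ∸ l) *ℤ G b m l
    ≡⟨ cong₂ (λ x y → x +ℤ b ^ℤ (m ∸ l) *ℤ y) (G≡0 b (ℕ.m<n⇒m<1+n m<l)) (G≡0 b m<l) ⟩
  0ℤ +ℤ b ^ℤ (m ∸ l) *ℤ 0ℤ  ≡⟨ solve₁ (b ^ℤ (m ∸ l)) ⟩
  0ℤ ∎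
  where
  open ≡-Reasoning
  solve₁ : ∀ x → 0ℤ +ℤ x *ℤ 0ℤ ≡ 0ℤ
  solve₁ = solve-∀

-- Both sides vanish for l > m, and also for l = m.
G-suc-lower : ∀ b m l →
  G b m (suc l) *ℤ (b ^ℤ suc l -ℤ 1ℤ) ≡ G b m l *ℤ (b ^ℤ (m ∸ l) -ℤ 1ℤ)
G-suc-lower b zero zero = refl
G-suc-lower b zero (suc l) = refl
G-suc-lower b (suc m) zero = begin
  (G b m 1 +ℤ x *ℤ 1ℤ) *ℤ (b *ℤ 1ℤ -ℤ 1ℤ)              ≡⟨ expand (G b m 1) x b ⟩
  G b m 1 *ℤ (b *ℤ 1ℤ -ℤ 1ℤ) +ℤ x *ℤ (b -ℤ 1ℤ)         ≡⟨ cong (_+ℤ x *ℤ (b -ℤ 1ℤ)) (G-suc-lower b m zero) ⟩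
  1ℤ *ℤ (x -ℤ 1ℤ) +ℤ x *ℤ (b -ℤ 1ℤ)                    ≡⟨ collect x b ⟩
  1ℤ *ℤ (b *ℤ x -ℤ 1ℤ) ∎
  where
  open ≡-Reasoning
  x = b ^ℤ m
  expand : ∀ g x b → (g +ℤ x *ℤ 1ℤ) *ℤ (b *ℤ 1ℤ -ℤ 1ℤ) ≡ g *ℤ (b *ℤ 1ℤ -ℤ 1ℤ) +ℤ x *ℤ (b -ℤ 1ℤ)
  expand = solve-∀
  collect : ∀ x b → 1ℤ *ℤ (x -ℤ 1ℤ) +ℤ x *ℤ (b -ℤ 1ℤ) ≡ 1ℤ *ℤ (b *ℤ x -ℤ 1ℤ)
  collect = solve-∀
G-suc-lower b (suc m) (suc l) = begin
  (G b m (suc (suc l)) +ℤ x *ℤ g) *ℤ (b *ℤ z -ℤ 1ℤ)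
    ≡⟨ expand (G b m (suc (suc l))) x g b z ⟩
  G b m (suc (suc l)) *ℤ (b *ℤ z -ℤ 1ℤ) +ℤ g *ℤ (b *ℤ z *ℤ x -ℤ x)
    ≡⟨ cong (_+ℤ g *ℤ (b *ℤ z *ℤ x -ℤ x)) (G-suc-lower b m (suc l)) ⟩
  g *ℤ (x -ℤ 1ℤ) +ℤ g *ℤ (b *ℤ z *ℤ x -ℤ x)
    ≡⟨ middle x g b z ⟩
  g *ℤ (b *ℤ x *ℤ z -ℤ 1ℤ)
    ≡⟨ same-power ⟩
  g *ℤ (y *ℤ z -ℤ 1ℤ)
    ≡⟨ middle′ y g z ⟩
  g *ℤ (y -ℤ 1ℤ) +ℤ y *ℤ (g *ℤ (z -ℤ 1ℤ))
    ≡⟨ cong (λ t → g *ℤ (y -ℤ 1ℤ) +ℤ y *ℤ t) (G-suc-lower b m l) ⟩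
  g *ℤ (y -ℤ 1ℤ) +ℤ y *ℤ (G b m l *ℤ (y -ℤ 1ℤ))
    ≡⟨ collect y g (G b m l) ⟩
  (g +ℤ y *ℤ G b m l) *ℤ (y -ℤ 1ℤ) ∎
  where
  open ≡-Reasoning
  g = G b m (suc l)
  x = b ^ℤ (m ∸ suc l)
  y = b ^ℤ (m ∸ l)
  z = b ^ℤ suc l
  expand : ∀ h x g b z →
    (h +ℤ x *ℤ g) *ℤ (b *ℤ z -ℤ 1ℤ) ≡ h *ℤ (b *ℤ z -ℤ 1ℤ) +ℤ g *ℤ (b *ℤ z *ℤ x -ℤ x)
  expand = solve-∀
  middle : ∀ x g b z →
    g *ℤ (x -ℤ 1ℤ) +ℤ g *ℤ (b *ℤ z *ℤ x -ℤ x) ≡ g *ℤ (b *ℤ x *ℤ z -ℤ 1ℤ)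
  middle = solve-∀
  middle′ : ∀ y g z →
    g *ℤ (y *ℤ z -ℤ 1ℤ) ≡ g *ℤ (y -ℤ 1ℤ) +ℤ y *ℤ (g *ℤ (z -ℤ 1ℤ))
  middle′ = solve-∀
  collect : ∀ y g h →
    g *ℤ (y -ℤ 1ℤ) +ℤ y *ℤ (h *ℤ (y -ℤ 1ℤ)) ≡ (g +ℤ y *ℤ h) *ℤ (y -ℤ 1ℤ)
  collect = solve-∀
  same-power : g *ℤ (b *ℤ x *ℤ z -ℤ 1ℤ) ≡ g *ℤ (y *ℤ z -ℤ 1ℤ)
  -- Truncated subtraction allows b x = y only for l < m; otherwise the common factor `g` vanishes.
  same-power with suc l ≤? m
  ... | yes l<m = cong (λ t → g *ℤ (t *ℤ z -ℤ 1ℤ)) (cong (b ^ℤ_) (≡-sym (ℕ.+-∸-assoc 1 l<m)))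
  ... | no l≮m = trans (cong (_*ℤ (b *ℤ x *ℤ z -ℤ 1ℤ)) g≡0)
                       (≡-sym (cong (_*ℤ (y *ℤ z -ℤ 1ℤ)) g≡0))
    where g≡0 = G≡0 b (ℕ.≰⇒> l≮m)

G-suc-suc : ∀ b {m l} → l ≤ m →
  G b (suc m) (suc l) *ℤ (b ^ℤ suc l -ℤ 1ℤ) ≡ G b m l *ℤ (b ^ℤ suc m -ℤ 1ℤ)
G-suc-suc b {m} {l} l≤m = begin
  (G b m (suc l) +ℤ y *ℤ g) *ℤ (z -ℤ 1ℤ)              ≡⟨ expand (G b m (suc l)) y g z ⟩
  G b m (suc l) *ℤ (z -ℤ 1ℤ) +ℤ y *ℤ g *ℤ (z -ℤ 1ℤ)   ≡⟨ cong (_+ℤ y *ℤ g *ℤ (z -ℤ 1ℤ)) (G-suc-lower b m l) ⟩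
  g *ℤ (y -ℤ 1ℤ) +ℤ y *ℤ g *ℤ (z -ℤ 1ℤ)               ≡⟨ collect y g z ⟩
  g *ℤ (y *ℤ z -ℤ 1ℤ)                                 ≡⟨ cong (λ t → g *ℤ (t -ℤ 1ℤ)) yz ⟩
  g *ℤ (b ^ℤ suc m -ℤ 1ℤ) ∎
  where
  open ≡-Reasoning
  g = G b m l
  y = b ^ℤ (m ∸ l)
  z = b ^ℤ suc l
  expand : ∀ h y g z → (h +ℤ y *ℤ g) *ℤ (z -ℤ 1ℤ) ≡ h *ℤ (z -ℤ 1ℤ) +ℤ y *ℤ g *ℤ (z -ℤ 1ℤ)
  expand = solve-∀
  collect : ∀ y g z → g *ℤ (y -ℤ 1ℤ) +ℤ y *ℤ g *ℤ (z -ℤ 1ℤ) ≡ g *ℤ (y *ℤ z -ℤ 1ℤ)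
  collect = solve-∀
  yz : y *ℤ z ≡ b ^ℤ suc m
  yz = trans (≡-sym (ℤ.^-distribˡ-+-* b (m ∸ l) (suc l)))
             (cong (b ^ℤ_) (trans (ℕ.+-suc (m ∸ l) l) (cong suc (ℕ.m∸n+n≡m l≤m))))

G-diagonal : ∀ b m → G b m m ≡ 1ℤ
G-diagonal b zero = refl
G-diagonal b (suc m) = begin
  G b m (suc m) +ℤ b ^ℤ (m ∸ m) *ℤ G b m m
    ≡⟨ cong₂ (λ x y → x +ℤ b ^ℤ y *ℤ G b m m) (G≡0 b {m} ℕ.≤-refl) (ℕ.n∸n≡0 m) ⟩
  0ℤ +ℤ 1ℤ *ℤ G b m m  ≡⟨ trans (ℤ.+-identityˡ _) (ℤ.*-identityˡ _) ⟩
  G b m m              ≡⟨ G-diagonal b m ⟩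
  1ℤ ∎
  where open ≡-Reasoning

-- Both sides equal [k+j+1, k+1]_b (b^(k+1) - 1): one by lowering the lower index, the other by
-- lowering both indices.
G-suc-upper : ∀ b k j →
  G b (k + suc j) k *ℤ (b ^ℤ suc j -ℤ 1ℤ) ≡ G b (k + j) k *ℤ (b ^ℤ suc (k + j) -ℤ 1ℤ)
G-suc-upper b k j = begin
  G b (k + suc j) k *ℤ (b ^ℤ suc j -ℤ 1ℤ)
    ≡⟨ cong (λ t → G b (k + suc j) k *ℤ (b ^ℤ t -ℤ 1ℤ)) (ℕ.m+n∸m≡n k (suc j)) ⟨
  G b (k + suc j) k *ℤ (b ^ℤ (k + suc j ∸ k) -ℤ 1ℤ)
    ≡⟨ G-suc-lower b (k + suc j) k ⟨
  G b (k + suc j) (suc k) *ℤ (b ^ℤ suc k -ℤ 1ℤ)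
    ≡⟨ cong (λ t → G b t (suc k) *ℤ (b ^ℤ suc k -ℤ 1ℤ)) (ℕ.+-suc k j) ⟩
  G b (suc (k + j)) (suc k) *ℤ (b ^ℤ suc k -ℤ 1ℤ)
    ≡⟨ G-suc-suc b (ℕ.m≤m+n k j) ⟩
  G b (k + j) k *ℤ (b ^ℤ suc (k + j) -ℤ 1ℤ) ∎
  where open ≡-Reasoning

-- The recurrence for the eigenvalue sums

sumℤ : ℕ → (ℕ → ℤ) → ℤ
sumℤ zero f = f 0
sumℤ (suc n) f = sumℤ n f +ℤ f (suc n)

sumTo≡sumℤ : ∀ n {f g} → (∀ {h} → h ≤ n → f h ≡ toℚ (g h)) → sumTo n f ≡ toℚ (sumℤ n g)
sumTo≡sumℤ zero f≡g = f≡g z≤n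
sumTo≡sumℤ (suc n) {f} {g} f≡g = trans
  (cong₂ _+ℚ_ (sumTo≡sumℤ n (λ h≤n → f≡g (ℕ.m≤n⇒m≤1+n h≤n))) (f≡g ℕ.≤-refl))
  (≡-sym (toℚ-+ (sumℤ n g) (g (suc n))))

sumℤ-shift : ∀ n c (e : ℕ → ℤ) {f g : ℕ → ℤ} → f 0 ≡ g 0 → (∀ h → f (suc h) ≡ g (suc h) +ℤ c *ℤ e h) →
  sumℤ (suc n) f ≡ sumℤ (suc n) g +ℤ c *ℤ sumℤ n e
sumℤ-shift zero c e {f} {g} f₀ f₊ = begin
  f 0 +ℤ f 1                   ≡⟨ cong₂ _+ℤ_ f₀ (f₊ 0) ⟩
  g 0 +ℤ (g 1 +ℤ c *ℤ e 0)     ≡⟨ ℤ.+-assoc (g 0) (g 1) (c *ℤ e 0) ⟨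
  g 0 +ℤ g 1 +ℤ c *ℤ e 0 ∎
  where open ≡-Reasoning
sumℤ-shift (suc n) c e {f} {g} f₀ f₊ = begin
  sumℤ (suc n) f +ℤ f (suc (suc n))
    ≡⟨ cong₂ _+ℤ_ (sumℤ-shift n c e f₀ f₊) (f₊ (suc n)) ⟩
  sumℤ (suc n) g +ℤ c *ℤ sumℤ n e +ℤ (g (suc (suc n)) +ℤ c *ℤ e (suc n))
    ≡⟨ rearrange (sumℤ (suc n) g) c (sumℤ n e) (g (suc (suc n))) (e (suc n)) ⟩
  sumℤ (suc n) g +ℤ g (suc (suc n)) +ℤ c *ℤ (sumℤ n e +ℤ e (suc n)) ∎
  where
  open ≡-Reasoning
  rearrange : ∀ s c t x y → s +ℤ c *ℤ t +ℤ (x +ℤ c *ℤ y) ≡ s +ℤ x +ℤ c *ℤ (t +ℤ y)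
  rearrange = solve-∀

-- With corank k = d - j and n = d - i this is (-1)^j Q_j(i).
S : ℤ → (k n j : ℕ) → ℤ
S b k n j = sumℤ j λ h → b ^ℤ (((j ∸ h) C 2) + h * (k + j)) *ℤ G b (k + (j ∸ h)) k *ℤ G b n h

-- Pascal's rule splits [n+1, h+1]_b. Raising h and j together keeps j - h, hence the binomial
-- exponent and the coefficient containing k, so the second parts of the terms add up to a multiple
-- of the sum for j.
S-suc : ∀ b k n j → S b k (suc n) (suc j) ≡ S b k n (suc j) +ℤ b ^ℤ (suc (k + j) + n) *ℤ S b k n j
S-suc b k n j = sumℤ-shift j (b ^ℤ (suc (k + j) + n)) _ refl step
  where
  step : ∀ h → _ ≡ _
  step h = begin
    b ^ℤ (c + suc h * (k + suc j)) *ℤ g *ℤ (G b n (suc h) +ℤ b ^ℤ (n ∸ h) *ℤ G b n h)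
      ≡⟨ expand (b ^ℤ (c + suc h * (k + suc j))) g (G b n (suc h)) (b ^ℤ (n ∸ h)) (G b n h) ⟩
    b ^ℤ (c + suc h * (k + suc j)) *ℤ g *ℤ G b n (suc h)
      +ℤ b ^ℤ (c + suc h * (k + suc j)) *ℤ b ^ℤ (n ∸ h) *ℤ (g *ℤ G b n h)
      ≡⟨ cong (b ^ℤ (c + suc h * (k + suc j)) *ℤ g *ℤ G b n (suc h) +ℤ_) powers ⟩
    b ^ℤ (c + suc h * (k + suc j)) *ℤ g *ℤ G b n (suc h)
      +ℤ b ^ℤ (suc (k + j) + n) *ℤ (b ^ℤ (c + h * (k + j)) *ℤ g *ℤ G b n h) ∎
    where
    open ≡-Reasoning
    c = (j ∸ h) C 2
    g = G b (k + (j ∸ h)) k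
    expand : ∀ p g x r y → p *ℤ g *ℤ (x +ℤ r *ℤ y) ≡ p *ℤ g *ℤ x +ℤ p *ℤ r *ℤ (g *ℤ y)
    expand = solve-∀
    exponents : h ≤ n → (c + suc h * (k + suc j)) + (n ∸ h) ≡ (suc (k + j) + n) + (c + h * (k + j))
    exponents h≤n = subst
      (λ t → (c + suc h * (k + suc j)) + (n ∸ h) ≡ (suc (k + j) + t) + (c + h * (k + j)))
      (ℕ.m∸n+n≡m h≤n) (arith c h k j (n ∸ h))
      where
      arith : ∀ c h k j r →
        (c + suc h * (k + suc j)) + r ≡ (suc (k + j) + (r + h)) + (c + h * (k + j))
      arith = NatSolver.solve-∀
    powers : b ^ℤ (c + suc h * (k + suc j)) *ℤ b ^ℤ (n ∸ h) *ℤ (g *ℤ G b n h)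
      ≡ b ^ℤ (suc (k + j) + n) *ℤ (b ^ℤ (c + h * (k + j)) *ℤ g *ℤ G b n h)
    powers with h ≤? n
    ... | yes h≤n = begin
      b ^ℤ (c + suc h * (k + suc j)) *ℤ b ^ℤ (n ∸ h) *ℤ (g *ℤ G b n h)
        ≡⟨ cong (_*ℤ (g *ℤ G b n h)) (ℤ.^-distribˡ-+-* b (c + suc h * (k + suc j)) (n ∸ h)) ⟨
      b ^ℤ ((c + suc h * (k + suc j)) + (n ∸ h)) *ℤ (g *ℤ G b n h)
        ≡⟨ cong (λ t → b ^ℤ t *ℤ (g *ℤ G b n h)) (exponents h≤n) ⟩
      b ^ℤ ((suc (k + j) + n) + (c + h * (k + j))) *ℤ (g *ℤ G b n h)
        ≡⟨ cong (_*ℤ (g *ℤ G b n h)) (ℤ.^-distribˡ-+-* b (suc (k + j) + n) (c + h * (k + j))) ⟩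
      b ^ℤ (suc (k + j) + n) *ℤ b ^ℤ (c + h * (k + j)) *ℤ (g *ℤ G b n h)
        ≡⟨ assoc (b ^ℤ (suc (k + j) + n)) (b ^ℤ (c + h * (k + j))) g (G b n h) ⟩
      b ^ℤ (suc (k + j) + n) *ℤ (b ^ℤ (c + h * (k + j)) *ℤ g *ℤ G b n h) ∎
      where
      assoc : ∀ p r g x → p *ℤ r *ℤ (g *ℤ x) ≡ p *ℤ (r *ℤ g *ℤ x)
      assoc = solve-∀
    -- Here n ∸ h is truncated, but both sides contain the factor [n, h]_b = 0.
    ... | no h≰n = subst
      (λ t → b ^ℤ (c + suc h * (k + suc j)) *ℤ b ^ℤ (n ∸ h) *ℤ (g *ℤ t)
           ≡ b ^ℤ (suc (k + j) + n) *ℤ (b ^ℤ (c + h * (k + j)) *ℤ g *ℤ t))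
      (≡-sym (G≡0 b (ℕ.≰⇒> h≰n)))
      (vanish (b ^ℤ (c + suc h * (k + suc j))) (b ^ℤ (n ∸ h)) g
              (b ^ℤ (suc (k + j) + n)) (b ^ℤ (c + h * (k + j))))
      where
      vanish : ∀ p r g s t → p *ℤ r *ℤ (g *ℤ 0ℤ) ≡ s *ℤ (t *ℤ g *ℤ 0ℤ)
      vanish = solve-∀

-- Separating signs from absolute values

sgn : ℕ → ℤ
sgn m = -1ℤ ^ℤ m

sgn-suc : ∀ m → sgn (suc m) ≡ -ℤ sgn m
sgn-suc m = ℤ.-1*i≡-i (sgn m)

sgn-+ : ∀ m n → sgn (m + n) ≡ sgn m *ℤ sgn n
sgn-+ = ℤ.^-distribˡ-+-* -1ℤ

sgn-square : ∀ m → sgn m *ℤ sgn m ≡ 1ℤ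
sgn-square zero = refl
sgn-square (suc m) = trans (flip (sgn m)) (sgn-square m)
  where
  flip : ∀ s → -1ℤ *ℤ s *ℤ (-1ℤ *ℤ s) ≡ s *ℤ s
  flip = solve-∀

base-^ : ∀ q m → base q ^ℤ m ≡ sgn m *ℤ (+ q) ^ℤ m
base-^ q zero = refl
base-^ q (suc m) = trans (cong (base q *ℤ_) (base-^ q m)) (rearrange (+ q) (sgn m) ((+ q) ^ℤ m))
  where
  rearrange : ∀ q s x → -ℤ q *ℤ (s *ℤ x) ≡ -1ℤ *ℤ s *ℤ (q *ℤ x)
  rearrange = solve-∀

sumℤ-head : ∀ n f → (∀ h → f (suc h) ≡ 0ℤ) → sumℤ n f ≡ f 0
sumℤ-head zero f f₊ = refl
sumℤ-head (suc n) f f₊ = trans (cong₂ _+ℤ_ (sumℤ-head n f f₊) (f₊ n)) (ℤ.+-identityʳ (f 0))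

C2-suc : ∀ j → suc j C 2 ≡ j + j C 2
C2-suc j = trans (≡-sym (nCk+nC[k+1]≡[n+1]C[k+1] j 1)) (cong (_+ j C 2) (nC1≡n j))

module Powers (q : ℕ) where

  p : ℕ → ℤ
  p m = (+ q) ^ℤ m

  -- For q ≥ 2 this is the absolute value of b^m - 1.
  a : ℕ → ℤ
  a m = p m -ℤ sgn m

  a-base : ∀ m → sgn m *ℤ (base q ^ℤ m -ℤ 1ℤ) ≡ a m
  a-base m = begin
    s *ℤ (base q ^ℤ m -ℤ 1ℤ)  ≡⟨ cong (λ t → s *ℤ (t -ℤ 1ℤ)) (base-^ q m) ⟩
    s *ℤ (s *ℤ x -ℤ 1ℤ)       ≡⟨ expand s x ⟩
    s *ℤ s *ℤ x -ℤ s          ≡⟨ cong (λ t → t *ℤ x -ℤ s) (sgn-square m) ⟩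
    1ℤ *ℤ x -ℤ s              ≡⟨ cong (_-ℤ s) (ℤ.*-identityˡ x) ⟩
    x -ℤ s ∎
    where
    open ≡-Reasoning
    s = sgn m
    x = p m
    expand : ∀ s x → s *ℤ (s *ℤ x -ℤ 1ℤ) ≡ s *ℤ s *ℤ x -ℤ s
    expand = solve-∀

-- σ n j = (-1)^(1 + min(j,n)) is the sign of the ratio of the two terms of the recurrence S-suc.
σ : ℕ → ℕ → ℤ
σ zero j = -1ℤ
σ (suc n) zero = -1ℤ
σ (suc n) (suc j) = -ℤ σ n j

module Magnitudes (q k : ℕ) where

  open Powers q

  c : ℕ → ℤ
  c n = p (suc (k + n))

  c-suc : ∀ n → c (suc n) ≡ + q *ℤ c n
  c-suc n = cong (λ m → p (suc m)) (ℕ.+-suc k n)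

  ε : ℕ → ℕ → ℤ
  ε n zero = 1ℤ
  ε n (suc j) = ε n j *ℤ (sgn (suc (k + n)) *ℤ σ n j)

  -- V n j turns out to be positive, so that ε n j is the sign and V n j the absolute value
  -- of b^(-C(j,2)) S b k n j.
  V : ℕ → ℕ → ℤ
  V zero j = sgn (k * j) *ℤ G (base q) (k + j) k
  V (suc n) zero = 1ℤ
  V (suc n) (suc j) = σ n j *ℤ V n (suc j) +ℤ c n *ℤ V n j

  V-zero : ∀ n → V n 0 ≡ 1ℤ
  V-zero zero rewrite ℕ.*-zeroʳ k | ℕ.+-identityʳ k =
    trans (ℤ.*-identityˡ _) (G-diagonal (base q) k)
  V-zero (suc n) = refl

  -- The sum in the recurrence takes the sign of its term b^(k+n+1) U_n(j). Raising n and j together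
  -- negates both new sign factors, and the two changes cancel.
  ε-suc : ∀ n j → ε (suc n) (suc j) ≡ ε n j *ℤ sgn (suc (k + n))
  ε-suc n zero = begin
    1ℤ *ℤ (sgn (suc (k + suc n)) *ℤ -1ℤ)    ≡⟨ cong (λ m → 1ℤ *ℤ (sgn (suc m) *ℤ -1ℤ)) (ℕ.+-suc k n) ⟩
    1ℤ *ℤ (-1ℤ *ℤ sgn (suc (k + n)) *ℤ -1ℤ) ≡⟨ cancel (sgn (suc (k + n))) ⟩
    1ℤ *ℤ sgn (suc (k + n)) ∎
    where
    open ≡-Reasoning
    cancel : ∀ s → 1ℤ *ℤ (-1ℤ *ℤ s *ℤ -1ℤ) ≡ 1ℤ *ℤ s
    cancel = solve-∀
  ε-suc n (suc j) = begin
    ε (suc n) (suc j) *ℤ (sgn (suc (k + suc n)) *ℤ (-ℤ σ n j))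
      ≡⟨ cong₂ (λ x m → x *ℤ (sgn (suc m) *ℤ (-ℤ σ n j))) (ε-suc n j) (ℕ.+-suc k n) ⟩
    ε n j *ℤ s *ℤ (-1ℤ *ℤ s *ℤ (-ℤ σ n j))
      ≡⟨ rearrange (ε n j) s (σ n j) ⟩
    ε n j *ℤ (s *ℤ σ n j) *ℤ s ∎
    where
    open ≡-Reasoning
    s = sgn (suc (k + n))
    rearrange : ∀ e s t → e *ℤ s *ℤ (-1ℤ *ℤ s *ℤ (-ℤ t)) ≡ e *ℤ (s *ℤ t) *ℤ s
    rearrange = solve-∀

  ε₀ : ∀ j → ε 0 j ≡ sgn (k * j)
  ε₀ zero rewrite ℕ.*-zeroʳ k = refl
  ε₀ (suc j) rewrite ℕ.+-identityʳ k | ℕ.*-suc k j = begin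
    ε 0 j *ℤ (-1ℤ *ℤ sgn k *ℤ -1ℤ)    ≡⟨ cong (_*ℤ (-1ℤ *ℤ sgn k *ℤ -1ℤ)) (ε₀ j) ⟩
    sgn (k * j) *ℤ (-1ℤ *ℤ sgn k *ℤ -1ℤ) ≡⟨ cancel (sgn (k * j)) (sgn k) ⟩
    sgn k *ℤ sgn (k * j)              ≡⟨ sgn-+ k (k * j) ⟨
    sgn (k + k * j) ∎
    where
    open ≡-Reasoning
    cancel : ∀ s t → s *ℤ (-1ℤ *ℤ t *ℤ -1ℤ) ≡ t *ℤ s
    cancel = solve-∀

  -- Since C(j+1,2) = j + C(j,2), taking out the power of b turns the coefficient b^(k+j+1+n) of
  -- `S-suc` into b^(k+n+1), which is `c n` up to sign and does not depend on j.
  S≡ : ∀ n j → S (base q) k n j ≡ base q ^ℤ (j C 2) *ℤ (ε n j *ℤ V n j)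
  S≡ zero j = begin
    S b k 0 j
      ≡⟨ sumℤ-head j _ (λ h → ℤ.*-zeroʳ (b ^ℤ (((j ∸ suc h) C 2) + suc h * (k + j)) *ℤ G b (k + (j ∸ suc h)) k)) ⟩
    b ^ℤ ((j C 2) + 0) *ℤ g *ℤ 1ℤ
      ≡⟨ cong (λ m → b ^ℤ m *ℤ g *ℤ 1ℤ) (ℕ.+-identityʳ (j C 2)) ⟩
    b ^ℤ (j C 2) *ℤ g *ℤ 1ℤ
      ≡⟨ swap (b ^ℤ (j C 2)) g ⟩
    b ^ℤ (j C 2) *ℤ (1ℤ *ℤ g)
      ≡⟨ cong (λ t → b ^ℤ (j C 2) *ℤ (t *ℤ g)) (sgn-square (k * j)) ⟨
    b ^ℤ (j C 2) *ℤ (sgn (k * j) *ℤ sgn (k * j) *ℤ g)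
      ≡⟨ cong (b ^ℤ (j C 2) *ℤ_) (ℤ.*-assoc (sgn (k * j)) (sgn (k * j)) g) ⟩
    b ^ℤ (j C 2) *ℤ (sgn (k * j) *ℤ V 0 j)
      ≡⟨ cong (λ t → b ^ℤ (j C 2) *ℤ (t *ℤ V 0 j)) (ε₀ j) ⟨
    b ^ℤ (j C 2) *ℤ (ε 0 j *ℤ V 0 j) ∎
    where
    open ≡-Reasoning
    b = base q
    g = G b (k + j) k
    swap : ∀ x y → x *ℤ y *ℤ 1ℤ ≡ x *ℤ (1ℤ *ℤ y)
    swap = solve-∀
  S≡ (suc n) zero rewrite ℕ.+-identityʳ k | G-diagonal (base q) k = refl
  S≡ (suc n) (suc j) = begin
    S b k (suc n) (suc j)
      ≡⟨ S-suc b k n j ⟩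
    S b k n (suc j) +ℤ b ^ℤ (suc (k + j) + n) *ℤ S b k n j
      ≡⟨ cong₂ (λ x y → x +ℤ b ^ℤ (suc (k + j) + n) *ℤ y) (S≡ n (suc j)) (S≡ n j) ⟩
    B *ℤ (ε n j *ℤ (s *ℤ σ n j) *ℤ V n (suc j))
      +ℤ b ^ℤ (suc (k + j) + n) *ℤ (b ^ℤ (j C 2) *ℤ (ε n j *ℤ V n j))
      ≡⟨ cong (B *ℤ (ε n j *ℤ (s *ℤ σ n j) *ℤ V n (suc j)) +ℤ_) powers ⟩
    B *ℤ (ε n j *ℤ (s *ℤ σ n j) *ℤ V n (suc j)) +ℤ B *ℤ (s *ℤ c n) *ℤ (ε n j *ℤ V n j)
      ≡⟨ collect B (ε n j) s (σ n j) (V n (suc j)) (c n) (V n j) ⟩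
    B *ℤ (ε n j *ℤ s *ℤ V (suc n) (suc j))
      ≡⟨ cong (λ t → B *ℤ (t *ℤ V (suc n) (suc j))) (ε-suc n j) ⟨
    B *ℤ (ε (suc n) (suc j) *ℤ V (suc n) (suc j)) ∎
    where
    open ≡-Reasoning
    b = base q
    B = b ^ℤ (suc j C 2)
    s = sgn (suc (k + n))
    collect : ∀ B e s t x c y →
      B *ℤ (e *ℤ (s *ℤ t) *ℤ x) +ℤ B *ℤ (s *ℤ c) *ℤ (e *ℤ y) ≡ B *ℤ (e *ℤ s *ℤ (t *ℤ x +ℤ c *ℤ y))
    collect = solve-∀
    exponent : ∀ k j n m → (suc (k + j) + n) + m ≡ (j + m) + suc (k + n)
    exponent = NatSolver.solve-∀
    powers : b ^ℤ (suc (k + j) + n) *ℤ (b ^ℤ (j C 2) *ℤ (ε n j *ℤ V n j))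
      ≡ B *ℤ (s *ℤ c n) *ℤ (ε n j *ℤ V n j)
    powers = begin
      b ^ℤ (suc (k + j) + n) *ℤ (b ^ℤ (j C 2) *ℤ (ε n j *ℤ V n j))
        ≡⟨ ℤ.*-assoc (b ^ℤ (suc (k + j) + n)) (b ^ℤ (j C 2)) (ε n j *ℤ V n j) ⟨
      b ^ℤ (suc (k + j) + n) *ℤ b ^ℤ (j C 2) *ℤ (ε n j *ℤ V n j)
        ≡⟨ cong (_*ℤ (ε n j *ℤ V n j)) (ℤ.^-distribˡ-+-* b (suc (k + j) + n) (j C 2)) ⟨
      b ^ℤ ((suc (k + j) + n) + j C 2) *ℤ (ε n j *ℤ V n j)
        ≡⟨ cong (λ m → b ^ℤ m *ℤ (ε n j *ℤ V n j)) (exponent k j n (j C 2)) ⟩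
      b ^ℤ ((j + j C 2) + suc (k + n)) *ℤ (ε n j *ℤ V n j)
        ≡⟨ cong (λ m → b ^ℤ (m + suc (k + n)) *ℤ (ε n j *ℤ V n j)) (C2-suc j) ⟨
      b ^ℤ ((suc j C 2) + suc (k + n)) *ℤ (ε n j *ℤ V n j)
        ≡⟨ cong (_*ℤ (ε n j *ℤ V n j)) (ℤ.^-distribˡ-+-* b (suc j C 2) (suc (k + n))) ⟩
      B *ℤ b ^ℤ suc (k + n) *ℤ (ε n j *ℤ V n j)
        ≡⟨ cong (λ t → B *ℤ t *ℤ (ε n j *ℤ V n j)) (base-^ q (suc (k + n))) ⟩
      B *ℤ (s *ℤ c n) *ℤ (ε n j *ℤ V n j) ∎

-- Integer inequalities and the ratio bound

positive-+ : ∀ {x y} → 0ℤ <ℤ x → 0ℤ ≤ℤ y → 0ℤ <ℤ x +ℤ y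
positive-+ = ℤ.+-mono-<-≤

nonNegative-+ : ∀ {x y} → 0ℤ ≤ℤ x → 0ℤ ≤ℤ y → 0ℤ ≤ℤ x +ℤ y
nonNegative-+ = ℤ.+-mono-≤

positive-* : ∀ {x y} → 0ℤ <ℤ x → 0ℤ <ℤ y → 0ℤ <ℤ x *ℤ y
positive-* {+ suc _} {+ suc _} _ _ = ℤB.+<+ ℕ.0<1+n
positive-* {+ zero} (ℤB.+<+ ()) _
positive-* {+ suc _} {+ zero} _ (ℤB.+<+ ())

nonNegative-* : ∀ {x y} → 0ℤ ≤ℤ x → 0ℤ ≤ℤ y → 0ℤ ≤ℤ x *ℤ y
nonNegative-* {+ m} {+ n} _ _ = subst (0ℤ ≤ℤ_) (ℤ.pos-* m n) (ℤB.+≤+ z≤n)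

positive-gap : ∀ {x y} → x <ℤ y → 0ℤ <ℤ y -ℤ x
positive-gap {x} {y} x<y = subst (_<ℤ y -ℤ x) (ℤ.+-inverseʳ x) (ℤ.+-monoˡ-< (-ℤ x) x<y)

scale>0 : ∀ n .{{_ : NonZero n}} {x} → 0ℤ <ℤ x → 0ℤ <ℤ + n *ℤ x
scale>0 (suc n) {x} = positive-* {+ suc n} {x} (ℤB.+<+ ℕ.0<1+n)

scale≥0 : ∀ n {x} → 0ℤ ≤ℤ x → 0ℤ ≤ℤ + n *ℤ x
scale≥0 n {x} = nonNegative-* {+ n} {x} (ℤB.+≤+ z≤n)

0≤1 : 0ℤ ≤ℤ 1ℤ
0≤1 = ℤB.+≤+ z≤n

0<1 : 0ℤ <ℤ 1ℤ
0<1 = ℤB.+<+ ℕ.0<1+n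

-- The multiple n + 1 lets certificates with rational coefficients be written over ℤ.
<-certificate : ∀ n {x y e} → 0ℤ <ℤ e → + suc n *ℤ (y -ℤ x) ≡ e → x <ℤ y
<-certificate n {x} {y} 0<e eq = subst₂ _<ℤ_ (ℤ.+-identityˡ x) cancel
  (ℤ.+-monoˡ-< x (ℤ.*-cancelˡ-<-nonNeg {0ℤ} {y -ℤ x} (+ suc n)
    (subst₂ _<ℤ_ (≡-sym (ℤ.*-zeroʳ (+ suc n))) (≡-sym eq) 0<e)))
  where
  cancel : y -ℤ x +ℤ x ≡ y
  cancel = solve (x ∷ y ∷ [])

≤-certificate : ∀ {x y e} → 0ℤ ≤ℤ e → y -ℤ x ≡ e → x ≤ℤ y
≤-certificate 0≤e eq = ℤ.0≤i-j⇒j≤i (subst (0ℤ ≤ℤ_) (≡-sym eq) 0≤e)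

-- For positive `y` this places the signed ratio r = τx/y in (-1/2, 1) without dividing. The sign is
-- an index, so matching substitutes its value.
data Bound (x y : ℤ) : ℤ → Set where
  negative : + 2 *ℤ x <ℤ y → Bound x y -1ℤ
  positive : x <ℤ y → Bound x y 1ℤ

-- In terms of r this is r < 1, used as 1 + r < 2 in `bound-step`.
bound-minus : ∀ {x y τ} → 0ℤ <ℤ x → Bound x y τ → 0ℤ <ℤ y -ℤ τ *ℤ x
bound-minus {x} {y} 0<x (negative 2x<y) =
  <-certificate 0 (positive-+ (positive-gap 2x<y) (scale≥0 3 (ℤ.<⇒≤ 0<x))) (solve (x ∷ y ∷ []))
bound-minus {x} {y} 0<x (positive x<y) =
  <-certificate 0 (positive-gap x<y) (solve (x ∷ y ∷ []))

bound-plus : ∀ {x y τ} → 0ℤ <ℤ x → Bound x y τ → 0ℤ <ℤ τ *ℤ x +ℤ y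
bound-plus {x} {y} 0<x (negative 2x<y) =
  <-certificate 0 (positive-+ 0<x (ℤ.<⇒≤ (positive-gap 2x<y))) (solve (x ∷ y ∷ []))
bound-plus {x} {y} 0<x (positive x<y) =
  <-certificate 0 (positive-+ (positive-gap x<y) (scale≥0 2 (ℤ.<⇒≤ 0<x))) (solve (x ∷ y ∷ []))

-- The constant -1/2 is sharp here: for negative r, |1 + 1/r| > 1 means r > -1/2.
bound-increases : ∀ {x y τ} → 0ℤ <ℤ y → Bound x y τ → x <ℤ τ *ℤ x +ℤ y
bound-increases {x} {y} 0<y (negative 2x<y) =
  <-certificate 0 (positive-gap 2x<y) (solve (x ∷ y ∷ []))
bound-increases {x} {y} 0<y (positive x<y) =
  <-certificate 0 0<y (solve (x ∷ y ∷ []))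

-- By `bound-minus`, τz + cy < 2cy. If 2y < cx, then 2cy < 2c(cx - y); if y < cx, then 4cy < 2c(cx +
-- y). The rest is q ≥ 2.
bound-step : ∀ {q c x y z σ τ} → + 2 ≤ℤ q → 0ℤ <ℤ c → 0ℤ <ℤ y → 0ℤ <ℤ z →
  Bound y (c *ℤ x) σ → Bound z (c *ℤ y) τ →
  Bound (τ *ℤ z +ℤ c *ℤ y) (q *ℤ c *ℤ (σ *ℤ y +ℤ c *ℤ x)) (-ℤ σ)
bound-step {q} {c} {x} {y} {z} {τ = τ} 2≤q 0<c 0<y 0<z (negative 2y<cx) bz =
  positive (<-certificate 0
    (positive-+ (bound-minus 0<z bz) (nonNegative-+
      (scale≥0 2 (ℤ.<⇒≤ (positive-* 0<c (positive-gap 2y<cx))))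
      (nonNegative-* (ℤ.i≤j⇒0≤j-i 2≤q)
        (ℤ.<⇒≤ (positive-* 0<c (positive-+ 0<y (ℤ.<⇒≤ (positive-gap 2y<cx))))))))
    (solve (q ∷ c ∷ x ∷ y ∷ z ∷ τ ∷ [])))
bound-step {q} {c} {x} {y} {z} {τ = τ} 2≤q 0<c 0<y 0<z (positive y<cx) bz =
  negative (<-certificate 0
    (positive-+ (scale>0 2 (bound-minus 0<z bz)) (nonNegative-+
      (scale≥0 2 (ℤ.<⇒≤ (positive-* 0<c (positive-gap y<cx))))
      (nonNegative-* (ℤ.i≤j⇒0≤j-i 2≤q)
        (ℤ.<⇒≤ (positive-* 0<c (positive-+ (scale>0 2 0<y) (ℤ.<⇒≤ (positive-gap y<cx))))))))
    (solve (q ∷ c ∷ x ∷ y ∷ z ∷ τ ∷ [])))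

-- The column j = 0 is constantly 1, so no earlier ratio enters: c - y is below c, and 2c ≤ qc.
bound-step₀ : ∀ {q c y} → + 2 ≤ℤ q → 0ℤ <ℤ c → 0ℤ <ℤ y →
  Bound (-1ℤ *ℤ y +ℤ c *ℤ 1ℤ) (q *ℤ c *ℤ 1ℤ) -1ℤ
bound-step₀ {q} {c} {y} 2≤q 0<c 0<y = negative (<-certificate 0
  (positive-+ (scale>0 2 0<y) (nonNegative-* (ℤ.i≤j⇒0≤j-i 2≤q) (ℤ.<⇒≤ 0<c)))
  (solve (q ∷ c ∷ y ∷ [])))

-- Estimates for powers, the values at n = 0, and the induction on n

sgn-bounds : ∀ m → 0ℤ ≤ℤ 1ℤ -ℤ sgn m × 0ℤ ≤ℤ 1ℤ +ℤ sgn m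
sgn-bounds zero = ℤB.+≤+ z≤n , ℤB.+≤+ z≤n
sgn-bounds (suc m) rewrite sgn-suc m with sgn-bounds m
... | lower , upper = subst (λ t → 0ℤ ≤ℤ 1ℤ +ℤ t) (≡-sym (ℤ.neg-involutive (sgn m))) upper , lower

-- The equation says u/v = β/α; this trades consecutive values of `V 0` for explicit powers.
ratio-≤ : ∀ {x y u v α β} → 0ℤ <ℤ α → 0ℤ <ℤ v → u *ℤ α ≡ v *ℤ β →
  x *ℤ β ≤ℤ y *ℤ α → x *ℤ u ≤ℤ y *ℤ v
ratio-≤ {x} {y} {u} {v} {α} {β} 0<α 0<v eq xβ≤yα =
  ℤ.*-cancelʳ-≤-pos (x *ℤ u) (y *ℤ v) α {{ℤB.positive 0<α}} (begin
    x *ℤ u *ℤ α    ≡⟨ ℤ.*-assoc x u α ⟩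
    x *ℤ (u *ℤ α)  ≡⟨ cong (x *ℤ_) eq ⟩
    x *ℤ (v *ℤ β)  ≡⟨ solve (x ∷ v ∷ β ∷ []) ⟩
    v *ℤ (x *ℤ β)  ≤⟨ ℤ.*-monoˡ-≤-nonNeg v {{ℤB.nonNegative (ℤ.<⇒≤ 0<v)}} xβ≤yα ⟩
    v *ℤ (y *ℤ α)  ≡⟨ solve (v ∷ y ∷ α ∷ []) ⟩
    y *ℤ v *ℤ α    ∎)
  where open ℤ.≤-Reasoning

ratio-< : ∀ {x y u v α β} → 0ℤ <ℤ α → 0ℤ <ℤ v → u *ℤ α ≡ v *ℤ β →
  x *ℤ β <ℤ y *ℤ α → x *ℤ u <ℤ y *ℤ v
ratio-< {x} {y} {u} {v} {α} {β} 0<α 0<v eq xβ<yα =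
  ℤ.*-cancelʳ-<-nonNeg α {{ℤB.nonNegative (ℤ.<⇒≤ 0<α)}} (begin-strict
    x *ℤ u *ℤ α    ≡⟨ ℤ.*-assoc x u α ⟩
    x *ℤ (u *ℤ α)  ≡⟨ cong (x *ℤ_) eq ⟩
    x *ℤ (v *ℤ β)  ≡⟨ solve (x ∷ v ∷ β ∷ []) ⟩
    v *ℤ (x *ℤ β)  <⟨ ℤ.*-monoˡ-<-pos v {{ℤB.positive 0<v}} xβ<yα ⟩
    v *ℤ (y *ℤ α)  ≡⟨ solve (v ∷ y ∷ α ∷ []) ⟩
    y *ℤ v *ℤ α    ∎)
  where open ℤ.≤-Reasoning

module PowerBounds (q : ℕ) (2≤q : 2 ≤ q) where

  open Powers q

  2≤+q : + 2 ≤ℤ + q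
  2≤+q = ℤB.+≤+ 2≤q

  1≤p : ∀ m → 0ℤ ≤ℤ p m -ℤ 1ℤ
  1≤p zero = ℤB.+≤+ z≤n
  1≤p (suc m) = step (+ q) (p m) (ℤ.i≤j⇒0≤j-i 2≤+q) (1≤p m)
    where
    step : ∀ q x → 0ℤ ≤ℤ q -ℤ + 2 → 0ℤ ≤ℤ x -ℤ 1ℤ → 0ℤ ≤ℤ q *ℤ x -ℤ 1ℤ
    step q x 0≤q-2 0≤x-1 = ≤-certificate {0ℤ} {q *ℤ x -ℤ 1ℤ}
      (nonNegative-+ (nonNegative-* 0≤q-2 0≤x-1)
        (nonNegative-+ (scale≥0 2 0≤x-1) (nonNegative-+ 0≤q-2 (ℤB.+≤+ {0} {1} z≤n))))
      (solve (q ∷ x ∷ []))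

  0<p : ∀ m → 0ℤ <ℤ p m
  0<p m = <-certificate 0 (positive-+ (ℤB.+<+ {0} {1} ℕ.0<1+n) (1≤p m)) (eq (p m))
    where
    eq : ∀ x → + 1 *ℤ (x -ℤ 0ℤ) ≡ + 1 +ℤ (x -ℤ 1ℤ)
    eq = solve-∀

  0<a : ∀ m → 0ℤ <ℤ a (suc m)
  0<a m = go (+ q) (p m) (sgn (suc m)) (ℤ.i≤j⇒0≤j-i 2≤+q) (1≤p m) (proj₁ (sgn-bounds (suc m)))
    where
    go : ∀ q x s → 0ℤ ≤ℤ q -ℤ + 2 → 0ℤ ≤ℤ x -ℤ 1ℤ → 0ℤ ≤ℤ 1ℤ -ℤ s → 0ℤ <ℤ q *ℤ x -ℤ s
    go q x s 0≤q-2 0≤x-1 0≤1-s = <-certificate 0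
      (positive-+ (ℤB.+<+ {0} {1} ℕ.0<1+n)
        (nonNegative-+ (nonNegative-* 0≤q-2 0≤x-1)
          (nonNegative-+ (scale≥0 2 0≤x-1) (nonNegative-+ 0≤q-2 0≤1-s))))
      (solve (q ∷ x ∷ s ∷ []))

module Bounds (q k : ℕ) (2≤q : 2 ≤ q) where

  open Magnitudes q k

  open Powers q
  open PowerBounds q 2≤q

  -- This is `G-suc-upper` with the signs removed, which match because k(j+1) + (j+1) = kj +
  -- (k+j+1).
  V₀-suc : ∀ j → V 0 (suc j) *ℤ a (suc j) ≡ V 0 j *ℤ a (suc (k + j))
  V₀-suc j = begin
    sgn (k * suc j) *ℤ g′ *ℤ a (suc j)
      ≡⟨ cong (sgn (k * suc j) *ℤ g′ *ℤ_) (a-base (suc j)) ⟨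
    sgn (k * suc j) *ℤ g′ *ℤ (sgn (suc j) *ℤ (b ^ℤ suc j -ℤ 1ℤ))
      ≡⟨ rearrange (sgn (k * suc j)) g′ (sgn (suc j)) (b ^ℤ suc j -ℤ 1ℤ) ⟩
    sgn (k * suc j) *ℤ sgn (suc j) *ℤ (g′ *ℤ (b ^ℤ suc j -ℤ 1ℤ))
      ≡⟨ cong₂ _*ℤ_ signs (G-suc-upper b k j) ⟩
    sgn (k * j) *ℤ sgn (suc (k + j)) *ℤ (g *ℤ (b ^ℤ suc (k + j) -ℤ 1ℤ))
      ≡⟨ rearrange (sgn (k * j)) g (sgn (suc (k + j))) (b ^ℤ suc (k + j) -ℤ 1ℤ) ⟨
    sgn (k * j) *ℤ g *ℤ (sgn (suc (k + j)) *ℤ (b ^ℤ suc (k + j) -ℤ 1ℤ))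
      ≡⟨ cong (sgn (k * j) *ℤ g *ℤ_) (a-base (suc (k + j))) ⟩
    sgn (k * j) *ℤ g *ℤ a (suc (k + j)) ∎
    where
    open ≡-Reasoning
    b = base q
    g = G b (k + j) k
    g′ = G b (k + suc j) k
    rearrange : ∀ s g t x → s *ℤ g *ℤ (t *ℤ x) ≡ s *ℤ t *ℤ (g *ℤ x)
    rearrange = solve-∀
    exponent : ∀ k j → k * suc j + suc j ≡ k * j + suc (k + j)
    exponent = NatSolver.solve-∀
    signs : sgn (k * suc j) *ℤ sgn (suc j) ≡ sgn (k * j) *ℤ sgn (suc (k + j))
    signs = trans (≡-sym (sgn-+ (k * suc j) (suc j)))
      (trans (cong sgn (exponent k j)) (sgn-+ (k * j) (suc (k + j))))

  0<V₀ : ∀ j → 0ℤ <ℤ V 0 j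
  0<V₀ zero = subst (0ℤ <ℤ_) (≡-sym (V-zero 0)) (ℤB.+<+ ℕ.0<1+n)
  0<V₀ (suc j) = ℤ.*-cancelʳ-<-nonNeg (a (suc j)) {{ℤB.nonNegative (ℤ.<⇒≤ (0<a j))}}
    (subst (0ℤ <ℤ_) (≡-sym (V₀-suc j)) (positive-* (0<V₀ j) (0<a (k + j))))

  c₀ : c 0 ≡ + q *ℤ p k
  c₀ = cong (λ m → p (suc m)) (ℕ.+-identityʳ k)

  a-sum : ∀ j → a (suc (k + j)) ≡ + q *ℤ (p k *ℤ p j) -ℤ sgn (suc (k + j))
  a-sum j = cong (λ t → + q *ℤ t -ℤ sgn (suc (k + j))) (ℤ.^-distribˡ-+-* (+ q) k j)

  V₀-≤ : ∀ x y j →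
    x *ℤ (+ q *ℤ (p k *ℤ p j) -ℤ sgn (suc (k + j))) ≤ℤ y *ℤ (+ q *ℤ p k) *ℤ (+ q *ℤ p j -ℤ sgn (suc j)) →
    x *ℤ V 0 (suc j) ≤ℤ y *ℤ c 0 *ℤ V 0 j
  V₀-≤ x y j h = ratio-≤ {x} {y *ℤ c 0} (0<a j) (0<V₀ j) (V₀-suc j)
    (subst₂ (λ s t → x *ℤ s ≤ℤ y *ℤ t *ℤ a (suc j)) (≡-sym (a-sum j)) (≡-sym c₀) h)

  V₀-≥ : ∀ x y j →
    y *ℤ (+ q *ℤ p k) *ℤ (+ q *ℤ p j -ℤ sgn (suc j)) ≤ℤ x *ℤ (+ q *ℤ (p k *ℤ p j) -ℤ sgn (suc (k + j))) →
    y *ℤ c 0 *ℤ V 0 j ≤ℤ x *ℤ V 0 (suc j)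
  V₀-≥ x y j h = ratio-≤ {y *ℤ c 0} {x} (0<a (k + j)) (0<V₀ (suc j)) (≡-sym (V₀-suc j))
    (subst₂ (λ s t → y *ℤ t *ℤ a (suc j) ≤ℤ x *ℤ s) (≡-sym (a-sum j)) (≡-sym c₀) h)

  V₀-< : ∀ x j →
    x *ℤ (+ q *ℤ (p k *ℤ p j) -ℤ sgn (suc (k + j))) <ℤ + q *ℤ p k *ℤ (+ q *ℤ p j -ℤ sgn (suc j)) →
    x *ℤ V 0 (suc j) <ℤ c 0 *ℤ V 0 j
  V₀-< x j h = ratio-< {x} {c 0} (0<a j) (0<V₀ j) (V₀-suc j)
    (subst₂ (λ s t → x *ℤ s <ℤ t *ℤ a (suc j)) (≡-sym (a-sum j)) (≡-sym c₀) h)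

  Inv : ℕ → Set
  Inv n = ∀ j → 0ℤ <ℤ V n j × Bound (V n (suc j)) (c n *ℤ V n j) (σ n j)

  inv-suc : ∀ {n} → Inv n → Inv (suc n)
  inv-suc {n} inv j = pos j , bound j
    where
    pos : ∀ j → 0ℤ <ℤ V (suc n) j
    pos zero = ℤB.+<+ ℕ.0<1+n
    pos (suc j) = bound-plus (proj₁ (inv (suc j))) (proj₂ (inv j))
    σ-zero : ∀ n → σ n 0 ≡ -1ℤ
    σ-zero zero = refl
    σ-zero (suc n) = refl
    bound : ∀ j → Bound (V (suc n) (suc j)) (c (suc n) *ℤ V (suc n) j) (σ (suc n) j)
    bound zero rewrite c-suc n | σ-zero n | V-zero n =
      bound-step₀ 2≤+q (0<p (suc (k + n))) (proj₁ (inv 1))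
    bound (suc j) rewrite c-suc n =
      bound-step 2≤+q (0<p (suc (k + n))) (proj₁ (inv (suc j))) (proj₁ (inv (suc (suc j))))
        (proj₂ (inv j)) (proj₂ (inv (suc j)))

  V-increases : ∀ {n} → Inv n → ∀ j → V n (suc j) <ℤ V (suc n) (suc j)
  V-increases {n} inv j =
    bound-increases (positive-* (0<p (suc (k + n))) (proj₁ (inv j))) (proj₂ (inv j))

-- Starting the induction for q ≥ 3 and for q = 2

module LargeBase (q k : ℕ) (3≤q : 3 ≤ q) where

  open Powers q
  open PowerBounds q (ℕ.<⇒≤ 3≤q)
  open Magnitudes q k
  open Bounds q k (ℕ.<⇒≤ 3≤q)

  inv₀ : Inv 0
  inv₀ j = 0<V₀ j , negative (V₀-< (+ 2) j
    (numeric (+ q) (p k) (p j) (sgn (suc (k + j))) (sgn (suc j))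
      0≤q-3 (1≤p k) (proj₂ (sgn-bounds (suc (k + j)))) (slack j)))
    where
    0≤q-3 : 0ℤ ≤ℤ + q -ℤ + 3
    0≤q-3 = ℤ.i≤j⇒0≤j-i (ℤB.+≤+ 3≤q)
    -- The two sides of `numeric` differ by qx((q - 2)y - t) + 2s. Once the bracket is at least 2,
    -- it outweighs the sign s; equality occurs for q = 3 and j = 0.
    slack : ∀ j → 0ℤ ≤ℤ (+ q -ℤ + 2) *ℤ p j -ℤ sgn (suc j) -ℤ + 2
    slack zero = ≤-certificate 0≤q-3 (eq (+ q))
      where
      eq : ∀ q → (q -ℤ + 2) *ℤ 1ℤ -ℤ -1ℤ -ℤ + 2 -ℤ 0ℤ ≡ q -ℤ + 3
      eq = solve-∀
    slack (suc j) = go (+ q) (p j) (sgn (suc (suc j))) 0≤q-3 (1≤p j) (proj₁ (sgn-bounds (suc (suc j))))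
      where
      go : ∀ q y s → 0ℤ ≤ℤ q -ℤ + 3 → 0ℤ ≤ℤ y -ℤ 1ℤ → 0ℤ ≤ℤ 1ℤ -ℤ s →
        0ℤ ≤ℤ (q -ℤ + 2) *ℤ (q *ℤ y) -ℤ s -ℤ + 2
      go q y s 0≤q-3 0≤y-1 0≤1-s = ≤-certificate
        (nonNegative-+ 0≤1-s (nonNegative-+ (scale≥0 3 0≤y-1) (nonNegative-+ (scale≥0 4 0≤q-3)
          (nonNegative-+ (scale≥0 4 (nonNegative-* 0≤q-3 0≤y-1))
            (nonNegative-* 0≤q-3 (nonNegative-* 0≤q-3 (nonNegative-+ 0≤y-1 0≤1)))))))
        (solve (q ∷ y ∷ s ∷ []))
    numeric : ∀ q x y s t → 0ℤ ≤ℤ q -ℤ + 3 → 0ℤ ≤ℤ x -ℤ 1ℤ → 0ℤ ≤ℤ 1ℤ +ℤ s →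
      0ℤ ≤ℤ (q -ℤ + 2) *ℤ y -ℤ t -ℤ + 2 →
      + 2 *ℤ (q *ℤ (x *ℤ y) -ℤ s) <ℤ q *ℤ x *ℤ (q *ℤ y -ℤ t)
    numeric q x y s t 0≤q-3 0≤x-1 0≤1+s 0≤w = <-certificate 0
      (positive-+ (scale>0 4 0<1)
        (nonNegative-+ (scale≥0 2 0≤1+s)
          (nonNegative-+ (scale≥0 6 0≤x-1)
            (nonNegative-+ (scale≥0 2 (nonNegative-* 0≤q-3 (nonNegative-+ 0≤x-1 0≤1)))
              (nonNegative-*
                (nonNegative-* (nonNegative-+ 0≤q-3 (scale≥0 3 0≤1)) (nonNegative-+ 0≤x-1 0≤1)) 0≤w)))))
      (solve (q ∷ x ∷ y ∷ s ∷ t ∷ []))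

-- For q = 2 and n = 0 the bound of Inv 0 can fail, but V 0 (j+1) / (c 0 V 0 j) is still at most 3/4,
-- and it is at least 3/8 for j ≥ 1; this is enough for Inv 1.
module BaseTwo (k : ℕ) where

  open Powers 2
  open PowerBounds 2 ℕ.≤-refl
  open Magnitudes 2 k
  open Bounds 2 k ℕ.≤-refl

  upper : ∀ j → + 4 *ℤ V 0 (suc j) ≤ℤ + 3 *ℤ c 0 *ℤ V 0 j
  upper zero = V₀-≤ (+ 4) (+ 3) 0
    (go (p k) (sgn (suc (k + 0))) (1≤p k) (proj₂ (sgn-bounds (suc (k + 0)))))
    where
    go : ∀ x s → 0ℤ ≤ℤ x -ℤ 1ℤ → 0ℤ ≤ℤ 1ℤ +ℤ s →
      + 4 *ℤ (+ 2 *ℤ (x *ℤ 1ℤ) -ℤ s) ≤ℤ + 3 *ℤ (+ 2 *ℤ x) *ℤ (+ 2 *ℤ 1ℤ -ℤ -1ℤ)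
    go x s 0≤x-1 0≤1+s = ≤-certificate
      (nonNegative-+ (scale≥0 10 0≤x-1) (nonNegative-+ (scale≥0 4 0≤1+s) (scale≥0 6 0≤1)))
      (solve (x ∷ s ∷ []))
  -- The constant 3/4 is attained here: for k = 1 the ratio is 9 / (3 · 4).
  upper (suc zero) = V₀-≤ (+ 4) (+ 3) 1
    (go (p k) (sgn (suc (k + 1))) (slack k))
    where
    slack : ∀ k → 0ℤ ≤ℤ (+ 2) ^ℤ k +ℤ + 2 *ℤ sgn (suc (k + 1))
    slack zero = ℤB.+≤+ z≤n
    slack (suc zero) = ℤB.+≤+ z≤n
    slack (suc (suc k)) = ≤-certificate
      (nonNegative-+ (scale≥0 4 (1≤p k)) (nonNegative-+
        (scale≥0 2 (proj₂ (sgn-bounds (suc (suc (suc k) + 1))))) (scale≥0 2 0≤1)))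
      (eq ((+ 2) ^ℤ k) (sgn (suc (suc (suc k) + 1))))
      where
      eq : ∀ x s → + 2 *ℤ (+ 2 *ℤ x) +ℤ + 2 *ℤ s -ℤ 0ℤ
        ≡ + 4 *ℤ (x -ℤ 1ℤ) +ℤ (+ 2 *ℤ (1ℤ +ℤ s) +ℤ + 2 *ℤ 1ℤ)
      eq = solve-∀
    go : ∀ x s → 0ℤ ≤ℤ x +ℤ + 2 *ℤ s →
      + 4 *ℤ (+ 2 *ℤ (x *ℤ + 2) -ℤ s) ≤ℤ + 3 *ℤ (+ 2 *ℤ x) *ℤ (+ 2 *ℤ + 2 -ℤ 1ℤ)
    go x s 0≤x+2s = ≤-certificate (scale≥0 2 0≤x+2s) (solve (x ∷ s ∷ []))
  upper (suc (suc j)) = V₀-≤ (+ 4) (+ 3) (suc (suc j))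
    (go (p k) (p j) (sgn (suc (k + suc (suc j)))) (sgn (suc (suc (suc j)))) (1≤p k) (1≤p j)
      (proj₂ (sgn-bounds (suc (k + suc (suc j))))) (proj₁ (sgn-bounds (suc (suc (suc j))))))
    where
    go : ∀ x y s t → 0ℤ ≤ℤ x -ℤ 1ℤ → 0ℤ ≤ℤ y -ℤ 1ℤ → 0ℤ ≤ℤ 1ℤ +ℤ s → 0ℤ ≤ℤ 1ℤ -ℤ t →
      + 4 *ℤ (+ 2 *ℤ (x *ℤ (+ 2 *ℤ (+ 2 *ℤ y))) -ℤ s)
        ≤ℤ + 3 *ℤ (+ 2 *ℤ x) *ℤ (+ 2 *ℤ (+ 2 *ℤ (+ 2 *ℤ y)) -ℤ t)
    go x y s t 0≤x-1 0≤y-1 0≤1+s 0≤1-t = ≤-certificate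
      (nonNegative-+ (scale≥0 16 (nonNegative-* (nonNegative-+ 0≤x-1 0≤1) 0≤y-1))
        (nonNegative-+ (scale≥0 6 (nonNegative-* (nonNegative-+ 0≤x-1 0≤1) 0≤1-t))
          (nonNegative-+ (scale≥0 10 0≤x-1) (nonNegative-+ (scale≥0 4 0≤1+s) (scale≥0 6 0≤1)))))
      (solve (x ∷ y ∷ s ∷ t ∷ []))

  -- Given the upper bound 3/4, `inv₁` needs a ratio above 1/3. The ratio of `V 0 1` to `c 0` is
  -- close to 1/3 and can lie below it, hence the shifted index.
  lower : ∀ j → + 3 *ℤ c 0 *ℤ V 0 (suc j) ≤ℤ + 8 *ℤ V 0 (suc (suc j))
  lower zero = V₀-≥ (+ 8) (+ 3) 1
    (go (p k) (sgn (suc (k + 1))) (1≤p k) (proj₁ (sgn-bounds (suc (k + 1)))))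
    where
    go : ∀ x s → 0ℤ ≤ℤ x -ℤ 1ℤ → 0ℤ ≤ℤ 1ℤ -ℤ s →
      + 3 *ℤ (+ 2 *ℤ x) *ℤ (+ 2 *ℤ + 2 -ℤ 1ℤ) ≤ℤ + 8 *ℤ (+ 2 *ℤ (x *ℤ + 2) -ℤ s)
    go x s 0≤x-1 0≤1-s = ≤-certificate
      (nonNegative-+ (scale≥0 14 0≤x-1) (nonNegative-+ (scale≥0 8 0≤1-s) (scale≥0 6 0≤1)))
      (solve (x ∷ s ∷ []))
  lower (suc j) = V₀-≥ (+ 8) (+ 3) (suc (suc j))
    (go (p k) (p j) (sgn (suc (k + suc (suc j)))) (sgn (suc (suc (suc j)))) (1≤p k) (1≤p j)
      (proj₁ (sgn-bounds (suc (k + suc (suc j))))) (proj₂ (sgn-bounds (suc (suc (suc j))))))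
    where
    go : ∀ x y s t → 0ℤ ≤ℤ x -ℤ 1ℤ → 0ℤ ≤ℤ y -ℤ 1ℤ → 0ℤ ≤ℤ 1ℤ -ℤ s → 0ℤ ≤ℤ 1ℤ +ℤ t →
      + 3 *ℤ (+ 2 *ℤ x) *ℤ (+ 2 *ℤ (+ 2 *ℤ (+ 2 *ℤ y)) -ℤ t)
        ≤ℤ + 8 *ℤ (+ 2 *ℤ (x *ℤ (+ 2 *ℤ (+ 2 *ℤ y))) -ℤ s)
    go x y s t 0≤x-1 0≤y-1 0≤1-s 0≤1+t = ≤-certificate
      (nonNegative-+ (scale≥0 16 (nonNegative-* (nonNegative-+ 0≤x-1 0≤1) 0≤y-1))
        (nonNegative-+ (scale≥0 6 (nonNegative-* (nonNegative-+ 0≤x-1 0≤1) 0≤1+t))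
          (nonNegative-+ (scale≥0 10 0≤x-1) (nonNegative-+ (scale≥0 8 0≤1-s) (scale≥0 2 0≤1)))))
      (solve (x ∷ y ∷ s ∷ t ∷ []))

  inv₁ : Inv 1
  inv₁ j = pos j , bound j
    where
    pos : ∀ j → 0ℤ <ℤ V 1 j
    pos zero = 0<1
    pos (suc j) = go (c 0) (V 0 j) (V 0 (suc j)) (0<V₀ (suc j)) (upper j)
      where
      go : ∀ c x y → 0ℤ <ℤ y → + 4 *ℤ y ≤ℤ + 3 *ℤ c *ℤ x → 0ℤ <ℤ -1ℤ *ℤ y +ℤ c *ℤ x
      go c x y 0<y h = <-certificate 2 (positive-+ 0<y (ℤ.i≤j⇒0≤j-i h)) (solve (c ∷ x ∷ y ∷ []))
    bound : ∀ j → Bound (V 1 (suc j)) (c 1 *ℤ V 1 j) (σ 1 j)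
    bound zero rewrite c-suc 0 | V-zero 0 = bound-step₀ 2≤+q (0<p (suc (k + 0))) (0<V₀ 1)
    bound (suc j) rewrite c-suc 0 = positive
      (go (c 0) (V 0 j) (V 0 (suc j)) (V 0 (suc (suc j)))
        (0<p (suc (k + 0))) (0<V₀ (suc j)) (upper j) (lower j))
      where
      go : ∀ c x y z → 0ℤ <ℤ c → 0ℤ <ℤ y → + 4 *ℤ y ≤ℤ + 3 *ℤ c *ℤ x → + 3 *ℤ c *ℤ y ≤ℤ + 8 *ℤ z →
        -1ℤ *ℤ z +ℤ c *ℤ y <ℤ + 2 *ℤ c *ℤ (-1ℤ *ℤ y +ℤ c *ℤ x)
      -- The bounds give 2c(cx - y) ≥ (2/3)cy and cy - z ≤ (5/8)cy, which leaves at least cy/24.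
      go c x y z 0<c 0<y hxy hyz = <-certificate 23
        (positive-+ (positive-* 0<c 0<y) (nonNegative-+
          (scale≥0 16 (nonNegative-* (ℤ.<⇒≤ 0<c) (ℤ.i≤j⇒0≤j-i hxy)))
          (scale≥0 3 (ℤ.i≤j⇒0≤j-i hyz))))
        (solve (c ∷ x ∷ y ∷ z ∷ []))

  V₀<V₂ : ∀ j → V 0 (suc (suc j)) <ℤ V 2 (suc (suc j))
  V₀<V₂ j rewrite c-suc 0 = go (c 0) (V 0 j) (V 0 (suc j)) (V 0 (suc (suc j)))
    (0<p (suc (k + 0))) (0<V₀ (suc j)) (upper j) (upper (suc j))
    where
    go : ∀ c x y z → 0ℤ <ℤ c → 0ℤ <ℤ y →
      + 4 *ℤ y ≤ℤ + 3 *ℤ c *ℤ x → + 4 *ℤ z ≤ℤ + 3 *ℤ c *ℤ y →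
      z <ℤ 1ℤ *ℤ (-1ℤ *ℤ z +ℤ c *ℤ y) +ℤ + 2 *ℤ c *ℤ (-1ℤ *ℤ y +ℤ c *ℤ x)
    -- From 2c(cx - y) ≥ (2/3)cy and 2z ≤ (3/2)cy, the gap is at least (1 + 2/3 - 3/2)cy = cy/6.
    go c x y z 0<c 0<y hxy hyz = <-certificate 5
      (positive-+ (positive-* 0<c 0<y) (nonNegative-+
        (scale≥0 4 (nonNegative-* (ℤ.<⇒≤ 0<c) (ℤ.i≤j⇒0≤j-i hxy)))
        (scale≥0 3 (ℤ.i≤j⇒0≤j-i hyz))))
      (solve (c ∷ x ∷ y ∷ z ∷ []))

  -- For q = 2 the bound at n = 0 reduces to 2^k (-1)^(j+1) < (-1)^(k+j+1), which holds exactly when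
  -- j + 1 is odd and k ≠ 0. This is the source of the exceptions in (i).
  V₀<V₁ : ∀ j → k ≢ 0 → sgn (suc j) ≡ -1ℤ → V 0 (suc j) <ℤ V 1 (suc j)
  V₀<V₁ j k≢0 odd = bound-increases (positive-* (0<p (suc (k + 0))) (0<V₀ j))
    (negative (V₀-< (+ 2) j (subst
      (λ t → + 2 *ℤ (+ 2 *ℤ (p k *ℤ p j) -ℤ sgn (suc (k + j))) <ℤ + 2 *ℤ p k *ℤ (+ 2 *ℤ p j -ℤ t))
      (≡-sym odd)
      (go (p k) (p j) (sgn (suc (k + j))) (2≤p k k≢0) (proj₂ (sgn-bounds (suc (k + j))))))))
    where
    2≤p : ∀ k → k ≢ 0 → 0ℤ ≤ℤ (+ 2) ^ℤ k -ℤ + 2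
    2≤p zero k≢0 = contradiction refl k≢0
    2≤p (suc k) _ = ≤-certificate (scale≥0 2 (1≤p k)) (eq ((+ 2) ^ℤ k))
      where
      eq : ∀ x → + 2 *ℤ x -ℤ + 2 -ℤ 0ℤ ≡ + 2 *ℤ (x -ℤ 1ℤ)
      eq = solve-∀
    go : ∀ x y s → 0ℤ ≤ℤ x -ℤ + 2 → 0ℤ ≤ℤ 1ℤ +ℤ s →
      + 2 *ℤ (+ 2 *ℤ (x *ℤ y) -ℤ s) <ℤ + 2 *ℤ x *ℤ (+ 2 *ℤ y -ℤ -1ℤ)
    go x y s 0≤x-2 0≤1+s = <-certificate 0
      (positive-+ (scale>0 2 0<1) (nonNegative-+ (scale≥0 2 0≤x-2) (scale≥0 2 0≤1+s)))
      (solve (x ∷ y ∷ s ∷ []))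

-- Signs and parity

IsSign : ℤ → Set
IsSign s = s ≡ 1ℤ ⊎ s ≡ -1ℤ

isSign-* : ∀ {s t} → IsSign s → IsSign t → IsSign (s *ℤ t)
isSign-* (inj₁ refl) (inj₁ refl) = inj₁ refl
isSign-* (inj₁ refl) (inj₂ refl) = inj₂ refl
isSign-* (inj₂ refl) (inj₁ refl) = inj₂ refl
isSign-* (inj₂ refl) (inj₂ refl) = inj₁ refl

isSign-sgn : ∀ m → IsSign (sgn m)
isSign-sgn zero = inj₁ refl
isSign-sgn (suc m) = isSign-* (inj₂ refl) (isSign-sgn m)

isSign-σ : ∀ n j → IsSign (σ n j)
isSign-σ zero j = inj₂ refl
isSign-σ (suc n) zero = inj₂ refl
isSign-σ (suc n) (suc j) = subst IsSign (ℤ.-1*i≡-i (σ n j)) (isSign-* (inj₂ refl) (isSign-σ n j))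

∣sign*∣ : ∀ {s x} → IsSign s → 0ℤ <ℤ x → + ∣ s *ℤ x ∣ℤ ≡ x
∣sign*∣ {x = x} (inj₁ refl) 0<x =
  trans (cong (λ t → + ∣ t ∣ℤ) (ℤ.*-identityˡ x)) (ℤ.0≤i⇒+∣i∣≡i (ℤ.<⇒≤ 0<x))
∣sign*∣ {x = x} (inj₂ refl) 0<x = trans (cong +_ (trans (cong ∣_∣ℤ (ℤ.-1*i≡-i x)) (ℤ.∣-i∣≡∣i∣ x)))
  (ℤ.0≤i⇒+∣i∣≡i (ℤ.<⇒≤ 0<x))

-x≤sign*x : ∀ {s x} → IsSign s → 0ℤ <ℤ x → -1ℤ *ℤ x ≤ℤ s *ℤ x
-x≤sign*x {x = x} (inj₁ refl) 0<x = ≤-certificate (scale≥0 2 (ℤ.<⇒≤ 0<x)) (solve (x ∷ []))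
-x≤sign*x (inj₂ refl) 0<x = ℤ.≤-refl

parity : ∀ j → (2 ∣ j × sgn j ≡ 1ℤ) ⊎ (¬ 2 ∣ j × sgn j ≡ -1ℤ)
parity zero = inj₁ (2 ∣0 , refl)
parity (suc zero) = inj₂ ((λ 2∣1 → contradiction (∣1⇒≡1 2∣1) λ ()) , refl)
parity (suc (suc j)) with parity j
... | inj₁ (2∣j , even) = inj₁ (∣m∣n⇒∣m+n ∣-refl 2∣j , cong (λ s → -1ℤ *ℤ (-1ℤ *ℤ s)) even)
... | inj₂ (2∤j , odd) =
  inj₂ ((λ 2∣2+j → 2∤j (∣m+n∣m⇒∣n 2∣2+j ∣-refl)) , cong (λ s → -1ℤ *ℤ (-1ℤ *ℤ s)) odd)

even⇒sgn : ∀ {j} → 2 ∣ j → sgn j ≡ 1ℤ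
even⇒sgn {j} 2∣j with parity j
... | inj₁ (_ , even) = even
... | inj₂ (2∤j , _) = contradiction 2∣j 2∤j

odd⇒sgn : ∀ {j} → ¬ 2 ∣ j → sgn j ≡ -1ℤ
odd⇒sgn {j} 2∤j with parity j
... | inj₁ (2∣j , _) = contradiction 2∣j 2∤j
... | inj₂ (_ , odd) = odd

σ-below : ∀ {n j} → j ≤ n → σ n j ≡ sgn (suc j)
σ-below {zero} z≤n = refl
σ-below {suc n} z≤n = refl
σ-below {suc n} {suc j} (s≤s j≤n) =
  trans (cong -ℤ_ (σ-below j≤n)) (≡-sym (sgn-suc (suc j)))

σ-above : ∀ n → σ n (suc n) ≡ sgn (suc n)
σ-above zero = refl
σ-above (suc n) = trans (cong -ℤ_ (σ-above n)) (≡-sym (sgn-suc (suc n)))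

-- Signs and absolute values of the eigenvalues

module Eigenvalues (q k : ℕ) (2≤q : 2 ≤ q) where

  open Powers q
  open PowerBounds q 2≤q
  open Magnitudes q k
  open Bounds q k 2≤q

  gaussProd≡G : ∀ m l → l ≤ m → gaussProd q m l ≡ toℚ (G (base q) m l)
  gaussProd≡G m zero _ = refl
  gaussProd≡G m (suc l) l<m = begin
    gaussProd q m l *ℚ (toℚ (b ^ℤ (m ∸ suc l + 1) -ℤ 1ℤ) ÷' y)
      ≡⟨ cong₂ (λ g e → g *ℚ (toℚ (b ^ℤ e -ℤ 1ℤ) ÷' y)) (gaussProd≡G m l (ℕ.<⇒≤ l<m))
           (trans (ℕ.+-comm (m ∸ suc l) 1) (≡-sym (ℕ.+-∸-assoc 1 l<m))) ⟩
    toℚ (G b m l) *ℚ (toℚ (b ^ℤ (m ∸ l) -ℤ 1ℤ) ÷' y)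
      ≡⟨ toℚ-÷' (G b m l) (G b m (suc l)) denominator≢0 (≡-sym (G-suc-lower b m l)) ⟩
    toℚ (G b m (suc l)) ∎
    where
    open ≡-Reasoning
    b = base q
    y = toℚ (b ^ℤ suc l -ℤ 1ℤ)
    denominator≢0 : b ^ℤ suc l -ℤ 1ℤ ≢ 0ℤ
    denominator≢0 y≡0 = ℤ.<⇒≢ (0<a l) (≡-sym (trans (≡-sym (a-base (suc l)))
      (trans (cong (sgn (suc l) *ℤ_) y≡0) (ℤ.*-zeroʳ (sgn (suc l))))))

  gauss≡G : ∀ m l → gauss q m l ≡ toℚ (G (base q) m l)
  gauss≡G m l with l ≤? m
  ... | yes l≤m = gaussProd≡G m l l≤m
  ... | no l≰m = cong toℚ (≡-sym (G≡0 (base q) (ℕ.≰⇒> l≰m)))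

  M : ℕ → ℕ → ℤ
  M n j = p (j C 2) *ℤ V n j

  τ : ℕ → ℕ → ℤ
  τ n j = sgn j *ℤ (sgn (j C 2) *ℤ ε n j)

  Q≡ : ∀ j i {n} → k + j ∸ i ≡ n → Q q (k + j) j i ≡ toℚ (τ n j *ℤ M n j)
  Q≡ j i {n} refl = begin
    toℚ (sgn j) *ℚ sumTo j _
      ≡⟨ cong (toℚ (sgn j) *ℚ_) (sumTo≡sumℤ j term) ⟩
    toℚ (sgn j) *ℚ toℚ (S b k n j)
      ≡⟨ toℚ-* (sgn j) (S b k n j) ⟨
    toℚ (sgn j *ℤ S b k n j)
      ≡⟨ cong (λ t → toℚ (sgn j *ℤ t)) (S≡ n j) ⟩
    toℚ (sgn j *ℤ (b ^ℤ (j C 2) *ℤ (ε n j *ℤ V n j)))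
      ≡⟨ cong (λ t → toℚ (sgn j *ℤ (t *ℤ (ε n j *ℤ V n j)))) (base-^ q (j C 2)) ⟩
    toℚ (sgn j *ℤ (sgn (j C 2) *ℤ p (j C 2) *ℤ (ε n j *ℤ V n j)))
      ≡⟨ cong toℚ (rearrange (sgn j) (sgn (j C 2)) (p (j C 2)) (ε n j) (V n j)) ⟩
    toℚ (τ n j *ℤ M n j) ∎
    where
    open ≡-Reasoning
    b = base q
    rearrange : ∀ s t x e v → s *ℤ (t *ℤ x *ℤ (e *ℤ v)) ≡ s *ℤ (t *ℤ e) *ℤ (x *ℤ v)
    rearrange = solve-∀
    term : ∀ {h} → h ≤ j →
      toℚ (b ^ℤ (((j ∸ h) C 2) + h * (k + j))) *ℚ gauss q (k + j ∸ h) (k + j ∸ j) *ℚ gauss q n h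
      ≡ toℚ (b ^ℤ (((j ∸ h) C 2) + h * (k + j)) *ℤ G b (k + (j ∸ h)) k *ℤ G b n h)
    term {h} h≤j = begin
      x *ℚ gauss q (k + j ∸ h) (k + j ∸ j) *ℚ gauss q n h
        ≡⟨ cong₂ (λ m l → x *ℚ gauss q m l *ℚ gauss q n h) (ℕ.+-∸-assoc k h≤j) (ℕ.m+n∸n≡m k j) ⟩
      x *ℚ gauss q (k + (j ∸ h)) k *ℚ gauss q n h
        ≡⟨ cong₂ (λ g g′ → x *ℚ g *ℚ g′) (gauss≡G (k + (j ∸ h)) k) (gauss≡G n h) ⟩
      x *ℚ toℚ (G b (k + (j ∸ h)) k) *ℚ toℚ (G b n h)
        ≡⟨ cong (_*ℚ toℚ (G b n h)) (toℚ-* z (G b (k + (j ∸ h)) k)) ⟨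
      toℚ (z *ℤ G b (k + (j ∸ h)) k) *ℚ toℚ (G b n h)
        ≡⟨ toℚ-* (z *ℤ G b (k + (j ∸ h)) k) (G b n h) ⟨
      toℚ (z *ℤ G b (k + (j ∸ h)) k *ℤ G b n h) ∎
      where
      z = b ^ℤ (((j ∸ h) C 2) + h * (k + j))
      x = toℚ z

  isSign-ε : ∀ n j → IsSign (ε n j)
  isSign-ε n zero = inj₁ refl
  isSign-ε n (suc j) =
    isSign-* (isSign-ε n j) (isSign-* (isSign-sgn (suc (k + n))) (isSign-σ n j))

  isSign-τ : ∀ n j → IsSign (τ n j)
  isSign-τ n j = isSign-* (isSign-sgn j) (isSign-* (isSign-sgn (j C 2)) (isSign-ε n j))

  -- For i < j the minimum in `σ n i` is i, so the factors (-1)^(i+1) of the product defining `ε`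
  -- multiply to (-1)^(j + C(j,2)).
  ε-below : ∀ {n} j → j ≤ suc n → ε n j ≡ sgn (j * suc (k + n)) *ℤ (sgn j *ℤ sgn (j C 2))
  ε-below zero _ = refl
  ε-below {n} (suc j) (s≤s j≤n) = begin
    ε n j *ℤ (s *ℤ σ n j)
      ≡⟨ cong₂ (λ e t → e *ℤ (s *ℤ t)) (ε-below j (ℕ.m≤n⇒m≤1+n j≤n)) (σ-below j≤n) ⟩
    r *ℤ (sgn j *ℤ sgn (j C 2)) *ℤ (s *ℤ sgn (suc j))
      ≡⟨ rearrange r (sgn j) (sgn (j C 2)) s (sgn (suc j)) ⟩
    s *ℤ r *ℤ (sgn (suc j) *ℤ (sgn j *ℤ sgn (j C 2)))
      ≡⟨ cong₂ (λ x y → x *ℤ (sgn (suc j) *ℤ y)) (sgn-+ (suc (k + n)) (j * suc (k + n)))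
           (trans (cong sgn (C2-suc j)) (sgn-+ j (j C 2))) ⟨
    sgn (suc j * suc (k + n)) *ℤ (sgn (suc j) *ℤ sgn (suc j C 2)) ∎
    where
    open ≡-Reasoning
    s = sgn (suc (k + n))
    r = sgn (j * suc (k + n))
    rearrange : ∀ r x y s z → r *ℤ (x *ℤ y) *ℤ (s *ℤ z) ≡ s *ℤ r *ℤ (z *ℤ (x *ℤ y))
    rearrange = solve-∀

  τ-below : ∀ {n j} → j ≤ suc n → τ n j ≡ sgn j ^ℤ suc (k + n)
  τ-below {n} {j} j≤1+n = begin
    sgn j *ℤ (sgn (j C 2) *ℤ ε n j)
      ≡⟨ cong (λ e → sgn j *ℤ (sgn (j C 2) *ℤ e)) (ε-below j j≤1+n) ⟩
    sgn j *ℤ (sgn (j C 2) *ℤ (r *ℤ (sgn j *ℤ sgn (j C 2))))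
      ≡⟨ rearrange (sgn j) (sgn (j C 2)) r ⟩
    sgn j *ℤ sgn j *ℤ (sgn (j C 2) *ℤ sgn (j C 2)) *ℤ r
      ≡⟨ cong₂ (λ x y → x *ℤ y *ℤ r) (sgn-square j) (sgn-square (j C 2)) ⟩
    1ℤ *ℤ r
      ≡⟨ ℤ.*-identityˡ r ⟩
    r
      ≡⟨ ℤ.^-*-assoc -1ℤ j (suc (k + n)) ⟨
    sgn j ^ℤ suc (k + n) ∎
    where
    open ≡-Reasoning
    r = sgn (j * suc (k + n))
    rearrange : ∀ x y r → x *ℤ (y *ℤ (r *ℤ (x *ℤ y))) ≡ x *ℤ x *ℤ (y *ℤ y) *ℤ r
    rearrange = solve-∀

  τ-even : ∀ {n j} → sgn j ≡ 1ℤ → j ≤ suc n → τ n j ≡ 1ℤ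
  τ-even {n} even j≤1+n =
    trans (τ-below j≤1+n) (trans (cong (_^ℤ suc (k + n)) even) (ℤ.^-zeroˡ (suc (k + n))))

  -- With j = n + 2, the sign differs from the positive one at n + 1 only by `σ n (suc n)`, where
  -- the minimum is already capped at n. So n = j - 2, that is i = d - j + 2, is the largest n with
  -- a negative eigenvalue.
  τ-even-next : ∀ n → sgn (suc (suc n)) ≡ 1ℤ → τ n (suc (suc n)) ≡ -1ℤ
  τ-even-next n even = begin
    sgn j *ℤ (sgn (j C 2) *ℤ (ε n (suc n) *ℤ (s *ℤ σ n (suc n))))
      ≡⟨ rearrange (sgn j) (sgn (j C 2)) (ε n (suc n)) s (σ n (suc n)) ⟩
    sgn j *ℤ (sgn (j C 2) *ℤ (ε n (suc n) *ℤ s)) *ℤ σ n (suc n)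
      ≡⟨ cong₂ (λ e t → sgn j *ℤ (sgn (j C 2) *ℤ e) *ℤ t) (≡-sym (ε-suc n (suc n))) σ≡-1 ⟩
    τ (suc n) j *ℤ -1ℤ
      ≡⟨ cong (_*ℤ -1ℤ) (τ-even {suc n} {j} even ℕ.≤-refl) ⟩
    -1ℤ ∎
    where
    open ≡-Reasoning
    j = suc (suc n)
    s = sgn (suc (k + n))
    rearrange : ∀ x y e s t → x *ℤ (y *ℤ (e *ℤ (s *ℤ t))) ≡ x *ℤ (y *ℤ (e *ℤ s)) *ℤ t
    rearrange = solve-∀
    σ≡-1 : σ n (suc n) ≡ -1ℤ
    σ≡-1 = trans (σ-above n) (trans (≡-sym (ℤ.neg-involutive (sgn (suc n))))
      (cong -ℤ_ (trans (≡-sym (sgn-suc (suc n))) even)))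

  -- Here n = k + j is d - 1, that is i = 1, and the exponent k + n + 1 = 2k + (j + 1) in `τ-below`
  -- is odd.
  τ-odd₁ : ∀ j → sgn (suc j) ≡ -1ℤ → τ (k + j) (suc j) ≡ -1ℤ
  τ-odd₁ j odd = begin
    τ (k + j) (suc j)               ≡⟨ τ-below (s≤s (ℕ.m≤n+m j k)) ⟩
    sgn (suc j) ^ℤ suc (k + (k + j)) ≡⟨ cong (_^ℤ suc (k + (k + j))) odd ⟩
    -1ℤ *ℤ sgn (k + (k + j))        ≡⟨ cong (-1ℤ *ℤ_) (trans (sgn-+ k (k + j)) (cong (sgn k *ℤ_) (sgn-+ k j))) ⟩
    -1ℤ *ℤ (sgn k *ℤ (sgn k *ℤ sgn j)) ≡⟨ rearrange (sgn k) (sgn j) ⟩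
    sgn k *ℤ sgn k *ℤ sgn (suc j)   ≡⟨ cong₂ _*ℤ_ (sgn-square k) odd ⟩
    -1ℤ ∎
    where
    open ≡-Reasoning
    rearrange : ∀ s t → -1ℤ *ℤ (s *ℤ (s *ℤ t)) ≡ s *ℤ s *ℤ (-1ℤ *ℤ t)
    rearrange = solve-∀

  τ-odd₀ : ∀ j → sgn (suc j) ≡ -1ℤ → τ (suc (k + j)) (suc j) ≡ 1ℤ
  τ-odd₀ j odd = begin
    τ (suc (k + j)) (suc j)
      ≡⟨ τ-below (s≤s (ℕ.m≤n⇒m≤1+n (ℕ.m≤n+m j k))) ⟩
    sgn (suc j) ^ℤ suc (k + suc (k + j))
      ≡⟨ cong (λ m → sgn (suc j) ^ℤ suc m) (ℕ.+-suc k (k + j)) ⟩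
    sgn (suc j) *ℤ sgn (suc j) ^ℤ suc (k + (k + j))
      ≡⟨ cong (sgn (suc j) *ℤ_) (≡-sym (τ-below (s≤s (ℕ.m≤n+m j k)))) ⟩
    sgn (suc j) *ℤ τ (k + j) (suc j)
      ≡⟨ cong₂ _*ℤ_ odd (τ-odd₁ j odd) ⟩
    1ℤ ∎
    where open ≡-Reasoning

  -- Monotonicity in n

  two-or-more : q ≡ 2 ⊎ 3 ≤ q
  two-or-more = [ inj₂ , (λ 2≡q → inj₁ (≡-sym 2≡q)) ]′ (ℕ.m≤n⇒m<n∨m≡n 2≤q)

  inv : ∀ n → Inv (suc n)
  inv zero with two-or-more
  ... | inj₁ refl = BaseTwo.inv₁ k
  ... | inj₂ 3≤q = inv-suc (LargeBase.inv₀ q k 3≤q)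
  inv (suc n) = inv-suc (inv n)

  0<V : ∀ n j → 0ℤ <ℤ V n j
  0<V zero j = 0<V₀ j
  0<V (suc n) j = proj₁ (inv n j)

  V₀<V₁ : ∀ j → (q ≡ 2 → k ≢ 0 × sgn (suc j) ≡ -1ℤ) → V 0 (suc j) <ℤ V 1 (suc j)
  V₀<V₁ j ordinary with two-or-more
  ... | inj₁ refl = BaseTwo.V₀<V₁ k j (proj₁ (ordinary refl)) (proj₂ (ordinary refl))
  ... | inj₂ 3≤q = V-increases (LargeBase.inv₀ q k 3≤q) j

  V₀<V₂ : ∀ j → 2 ≤ k + suc j → V 0 (suc j) <ℤ V 2 (suc j)
  V₀<V₂ j 2≤d with two-or-more
  -- Index 1 is below the range of `BaseTwo.V₀<V₂`, but it is odd, and d ≥ 2 gives k ≠ 0, so even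
  -- |U_0| < |U_1| holds.
  V₀<V₂ zero 2≤d | inj₁ refl = ℤ.<-trans (BaseTwo.V₀<V₁ k 0 k≢0 refl) (V-increases (inv 0) 0)
    where
    k≢0 : k ≢ 0
    k≢0 refl = ℕ.<-irrefl refl 2≤d
  V₀<V₂ (suc j) 2≤d | inj₁ refl = BaseTwo.V₀<V₂ k j
  V₀<V₂ j 2≤d | inj₂ 3≤q =
    ℤ.<-trans (V-increases (LargeBase.inv₀ q k 3≤q) j) (V-increases (inv 0) j)

  V-mono-suc : ∀ j n m → n < m → V (suc n) (suc j) <ℤ V (suc m) (suc j)
  V-mono-suc j n (suc m) (s≤s n≤m) with ℕ.m≤n⇒m<n∨m≡n n≤m
  ... | inj₁ n<m = ℤ.<-trans (V-mono-suc j n m n<m) (V-increases (inv m) j)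
  ... | inj₂ refl = V-increases (inv n) j

  -- The condition `2 ≤ m` removes just the pair (0, 1), whose order can fail for q = 2.
  V-mono : ∀ j → 2 ≤ k + suc j → ∀ {n m} → n < m → 2 ≤ m → V n (suc j) <ℤ V m (suc j)
  V-mono j 2≤d {zero} {suc zero} _ (s≤s ())
  V-mono j 2≤d {zero} {suc (suc zero)} _ _ = V₀<V₂ j 2≤d
  V-mono j 2≤d {zero} {suc (suc (suc m))} _ _ =
    ℤ.<-trans (V₀<V₂ j 2≤d) (V-mono-suc j 1 (suc (suc m)) (s≤s (s≤s z≤n)))
  V-mono j 2≤d {suc n} {suc m} (s≤s n<m) _ = V-mono-suc j n m n<m

  0<M : ∀ n j → 0ℤ <ℤ M n j
  0<M n j = positive-* (0<p (j C 2)) (0<V n j)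

  V<⇒M< : ∀ j n m → V n j <ℤ V m j → M n j <ℤ M m j
  V<⇒M< j n m = ℤ.*-monoˡ-<-pos (p (j C 2)) {{ℤB.positive (0<p (j C 2))}}

  M-mono : ∀ j → 2 ≤ k + suc j → ∀ {n m} → n < m → 2 ≤ m → M n (suc j) <ℤ M m (suc j)
  M-mono j 2≤d {n} {m} n<m 2≤m = V<⇒M< (suc j) n m (V-mono j 2≤d n<m 2≤m)

  ∣Q∣≡ : ∀ j i {n} → k + j ∸ i ≡ n → ∣ Q q (k + j) j i ∣ ≡ toℚ (M n j)
  ∣Q∣≡ j i {n} eq = trans (cong ∣_∣ (Q≡ j i eq))
    (trans (∣toℚ∣ (τ n j *ℤ M n j)) (cong toℚ (∣sign*∣ (isSign-τ n j) (0<M n j))))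

  ∣Q∣-mono : ∀ j i i′ {n n′} → k + j ∸ i ≡ n → k + j ∸ i′ ≡ n′ → M n j <ℤ M n′ j →
    ∣ Q q (k + j) j i ∣ <ℚ ∣ Q q (k + j) j i′ ∣
  ∣Q∣-mono j i i′ eq eq′ M<M′ =
    subst₂ _<ℚ_ (≡-sym (∣Q∣≡ j i eq)) (≡-sym (∣Q∣≡ j i′ eq′)) (toℚ-mono-< M<M′)

  Q-mono : ∀ j i i′ {n n′} → k + j ∸ i ≡ n → k + j ∸ i′ ≡ n′ → τ n j *ℤ M n j ≤ℤ τ n′ j *ℤ M n′ j →
    Q q (k + j) j i ≤ℚ Q q (k + j) j i′
  Q-mono j i i′ eq eq′ ≤M =
    subst₂ _≤ℚ_ (≡-sym (Q≡ j i eq)) (≡-sym (Q≡ j i′ eq′)) (toℚ-mono-≤ ≤M)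

  -M≤ : ∀ j {n m} → τ n j ≡ -1ℤ → M m j ≤ℤ M n j → τ n j *ℤ M n j ≤ℤ τ m j *ℤ M m j
  -M≤ j {n} {m} τ≡-1 Mm≤Mn = begin
    τ n j *ℤ M n j  ≡⟨ cong (_*ℤ M n j) τ≡-1 ⟩
    -1ℤ *ℤ M n j    ≡⟨ ℤ.-1*i≡-i (M n j) ⟩
    -ℤ M n j        ≤⟨ ℤ.neg-mono-≤ Mm≤Mn ⟩
    -ℤ M m j        ≡⟨ ℤ.-1*i≡-i (M m j) ⟨
    -1ℤ *ℤ M m j    ≤⟨ -x≤sign*x (isSign-τ m j) (0<M m j) ⟩
    τ m j *ℤ M m j  ∎
    where open ℤ.≤-Reasoning

  -M≤+M : ∀ j {n m} → τ n j ≡ -1ℤ → τ m j ≡ 1ℤ → τ n j *ℤ M n j ≤ℤ τ m j *ℤ M m j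
  -M≤+M j {n} {m} τ≡-1 τ≡1 = begin
    τ n j *ℤ M n j  ≡⟨ cong (_*ℤ M n j) τ≡-1 ⟩
    -1ℤ *ℤ M n j    ≡⟨ ℤ.-1*i≡-i (M n j) ⟩
    -ℤ M n j        ≤⟨ ℤ.neg-mono-≤ (ℤ.<⇒≤ (0<M n j)) ⟩
    0ℤ              ≤⟨ ℤ.<⇒≤ (0<M m j) ⟩
    M m j           ≡⟨ ℤ.*-identityˡ (M m j) ⟨
    1ℤ *ℤ M m j     ≡⟨ cong (_*ℤ M m j) τ≡1 ⟨
    τ m j *ℤ M m j  ∎
    where open ℤ.≤-Reasoning

  M-mono-≤ : ∀ j → 2 ≤ k + suc j → ∀ {n m} → n ≤ m → (n < m → 2 ≤ m) → M n (suc j) ≤ℤ M m (suc j)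
  M-mono-≤ j 2≤d n≤m 2≤m with ℕ.m≤n⇒m<n∨m≡n n≤m
  ... | inj₁ n<m = ℤ.<⇒≤ (M-mono j 2≤d n<m (2≤m n<m))
  ... | inj₂ refl = ℤ.≤-refl

  -- The four assertions

  module _ (j : ℕ) (3≤d : 3 ≤ k + suc j) where

    private
      d = k + suc j

      d≡ : d ≡ suc (k + j)
      d≡ = ℕ.+-suc k j

      2≤d : 2 ≤ d
      2≤d = ℕ.<⇒≤ 3≤d

      2≤d-1 : 2 ≤ k + j
      2≤d-1 = ℕ.≤-pred (subst (3 ≤_) d≡ 3≤d)

      d∸suc : ∀ i → d ∸ suc i ≡ k + j ∸ i
      d∸suc i = cong (_∸ suc i) d≡

    ∣Q∣-decreasing : ∀ i → i < d → ¬ (q ≡ 2 × suc i ≡ d × (suc j ≡ d ⊎ 2 ∣ suc j)) →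
      ∣ Q q d (suc j) (suc i) ∣ <ℚ ∣ Q q d (suc j) i ∣
    ∣Q∣-decreasing i i<d ordinary = go (d ∸ suc i) refl
      where
      step : ∀ {n} → d ∸ suc i ≡ n → V n (suc j) <ℤ V (suc n) (suc j) →
        ∣ Q q d (suc j) (suc i) ∣ <ℚ ∣ Q q d (suc j) i ∣
      step {n} eq V<V = ∣Q∣-mono (suc j) (suc i) i eq (trans (ℕ.+-∸-assoc 1 i<d) (cong suc eq))
        (V<⇒M< (suc j) n (suc n) V<V)
      go : ∀ n → d ∸ suc i ≡ n → ∣ Q q d (suc j) (suc i) ∣ <ℚ ∣ Q q d (suc j) i ∣
      go (suc n) eq = step eq (V-increases (inv n) j)
      -- Now i = d - 1. As k = 0 means j = d, the excluded cases are those that `V₀<V₁` cannot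
      -- cover.
      go zero eq = step eq (V₀<V₁ j λ q≡2 →
        (λ k≡0 → ordinary (q≡2 , i≡d , inj₁ (cong (_+ suc j) (≡-sym k≡0)))) ,
        odd⇒sgn (λ 2∣j → ordinary (q≡2 , i≡d , inj₂ 2∣j)))
        where
        i≡d : suc i ≡ d
        i≡d = ℕ.≤-antisym i<d (ℕ.m∸n≡0⇒m≤n eq)

    -- Only i = 0 has a larger absolute value than i = 1, and there the sign is positive.
    Q-minimum-odd : ¬ 2 ∣ suc j → ∀ i → i ≤ d → Q q d (suc j) 1 ≤ℚ Q q d (suc j) i
    Q-minimum-odd 2∤j zero _ =
      Q-mono (suc j) 1 0 (d∸suc 0) d≡ (-M≤+M (suc j) (τ-odd₁ j odd) (τ-odd₀ j odd))
      where odd = odd⇒sgn 2∤j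
    Q-minimum-odd 2∤j (suc i) _ =
      Q-mono (suc j) 1 (suc i) (d∸suc 0) (d∸suc i) (-M≤ (suc j) (τ-odd₁ j (odd⇒sgn 2∤j))
        (M-mono-≤ j 2≤d (ℕ.m∸n≤m (k + j) i) (λ _ → 2≤d-1)))

    ∣Q∣-second : ∀ i → 2 ≤ i → i ≤ d → ∣ Q q d (suc j) i ∣ <ℚ ∣ Q q d (suc j) 1 ∣
    ∣Q∣-second (suc i) (s≤s 1≤i) i≤d = ∣Q∣-mono (suc j) (suc i) 1 (d∸suc i) (d∸suc 0)
      (M-mono j 2≤d (ℕ.∸-monoʳ-< 1≤i (ℕ.≤-pred (subst (suc i ≤_) d≡ i≤d))) 2≤d-1)

    Q-minimum-even : 2 ∣ suc j → ∀ i → i ≤ d → Q q d (suc j) (d ∸ suc j + 2) ≤ℚ Q q d (suc j) i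
    Q-minimum-even 2∣j i i≤d = go j refl (even⇒sgn 2∣j)
      where
      go : ∀ j′ → j ≡ j′ → sgn (suc j′) ≡ 1ℤ → Q q d (suc j) (d ∸ suc j + 2) ≤ℚ Q q d (suc j) i
      go zero _ ()
      go (suc n) refl even = Q-mono (suc j) (d ∸ suc j + 2) i position refl least
        where
        position : d ∸ (d ∸ suc j + 2) ≡ n
        position = trans (cong (λ t → d ∸ (t + 2)) (ℕ.m+n∸n≡m k (suc j))) (ℕ.[m+n]∸[m+o]≡n∸o k (suc j) 2)
        -- Since n + 2 is even, n is even and cannot be 1; this avoids comparing n = 0 with n = 1.
        n<⇒2≤ : ∀ {m} → m < n → 2 ≤ n
        n<⇒2≤ = big n even
          where
          big : ∀ n → sgn (suc (suc n)) ≡ 1ℤ → ∀ {m} → m < n → 2 ≤ n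
          big (suc zero) ()
          big (suc (suc n)) _ _ = s≤s (s≤s z≤n)
        least : τ n (suc j) *ℤ M n (suc j) ≤ℤ τ (d ∸ i) (suc j) *ℤ M (d ∸ i) (suc j)
        -- For d - i > n the eigenvalue is positive; for d - i ≤ n its absolute value is at most the
        -- one at n.
        least with suc n ≤? d ∸ i
        ... | yes n<d-i = -M≤+M (suc j) (τ-even-next n even) (τ-even even (s≤s n<d-i))
        ... | no n≮d-i = -M≤ (suc j) (τ-even-next n even) (M-mono-≤ j 2≤d (ℕ.≮⇒≥ n≮d-i) n<⇒2≤)

primePower⇒2≤ : ∀ {q} → IsPrimePower q → 2 ≤ q
primePower⇒2≤ (r , e , r-prime , 1≤e , refl) = begin
  2      ≤⟨ nonTrivial⇒n>1 r {{prime⇒nonTrivial r-prime}} ⟩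
  r      ≡⟨ ℕ.^-identityʳ r ⟨
  r ^ 1  ≤⟨ ℕ.^-monoʳ-≤ r {{prime⇒nonZero r-prime}} 1≤e ⟩
  r ^ e  ∎
  where open ℕ.≤-Reasoning

theorem5p10 : (q d j : ℕ) → IsPrimePower q → 6 ≤ d → 1 ≤ j → j ≤ d →
    ((i : ℕ) → i < d → ¬ (q ≡ 2 × suc i ≡ d × (j ≡ d ⊎ 2 ∣ j)) →
    ∣ Q q d j (suc i) ∣ <ℚ ∣ Q q d j i ∣)
    × (¬ (2 ∣ j) → (i : ℕ) → i ≤ d → Q q d j 1 ≤ℚ Q q d j i)
    × (2 ∣ j → (i : ℕ) → i ≤ d → Q q d j (d ∸ j + 2) ≤ℚ Q q d j i)
    × ((i : ℕ) → 2 ≤ i → i ≤ d → ∣ Q q d j i ∣ <ℚ ∣ Q q d j 1 ∣)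
theorem5p10 q d (suc j) isPrimePower 6≤d _ j≤d =
  subst Conclusion (ℕ.m∸n+n≡m j≤d) (conclusion (d ∸ suc j)
    (ℕ.≤-trans (s≤s (s≤s (s≤s z≤n))) (subst (6 ≤_) (≡-sym (ℕ.m∸n+n≡m j≤d)) 6≤d)))
  where
  Conclusion : ℕ → Set
  Conclusion d =
    ((i : ℕ) → i < d → ¬ (q ≡ 2 × suc i ≡ d × (suc j ≡ d ⊎ 2 ∣ suc j)) →
    ∣ Q q d (suc j) (suc i) ∣ <ℚ ∣ Q q d (suc j) i ∣)
    × (¬ (2 ∣ suc j) → (i : ℕ) → i ≤ d → Q q d (suc j) 1 ≤ℚ Q q d (suc j) i)
    × (2 ∣ suc j → (i : ℕ) → i ≤ d → Q q d (suc j) (d ∸ suc j + 2) ≤ℚ Q q d (suc j) i)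
    × ((i : ℕ) → 2 ≤ i → i ≤ d → ∣ Q q d (suc j) i ∣ <ℚ ∣ Q q d (suc j) 1 ∣)
  conclusion : ∀ k → 3 ≤ k + suc j → Conclusion (k + suc j)
  conclusion k 3≤d =
    ∣Q∣-decreasing j 3≤d , Q-minimum-odd j 3≤d , Q-minimum-even j 3≤d , ∣Q∣-second j 3≤d
    where open Eigenvalues q k (primePower⇒2≤ isPrimePower)
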